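{- Let $\Omega$ be a finite set, let $k,l \geq 2$ be multiplicatively independent integers, and let $f \colon \mathbb{N}_0 \to \Omega$ be a sequence. Suppose that $f$ is $k$-automatic and asymptotically $l$-automatic. Then $f$ is asymptotically equal to a periodic sequence, i.e. there exists a periodic sequence $\tilde f\colon\mathbb{N}_0\to\Omega$ with $f(n)=\tilde f(n)$ for almost all $n\in\mathbb{N}_0$.
   Context: $\mathbb{N}_0 = \{0,1,2,\dots\}$. Integers $k,l\geq 2$ are multiplicatively independent if $\log k/\log l \notin \mathbb{Q}$. For $A \subset \mathbb{N}_0$, the upper density is $\bar d(A) = \limsup_{N\to\infty} |A\cap\{0,\dots,N-1\}|/N$; a property holds for almost all $n\in\mathbb{N}_0$ if the set of $n$ where it fails has upper density $0$. Two sequences $f,g\colon \mathbb{N}_0\to\Omega$ are asymptotically equal, written $f\simeq g$, if $f(n)=g(n)$ for almost all $n$. The $k$-kernel of $f$ is $\mathcal{N}_k(f) = \{ n \mapsto f(k^\alpha n + r) : \alpha, r \in \mathbb{N}_0,\ r < k^\alpha\}$. The sequence $f$ is $k$-automatic if $\mathcal{N}_k(f)$ is finite, and asymptotically $l$-automatic if the set of equivalence classes $\mathcal{N}_l(f)/{\simeq}$ is finite. -}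

module Defs where

open import Data.Fin.Base using (Fin)
open import Data.Fin.Properties using (inj⇒≟)
open import Data.Integer.Base using (+_)
open import Data.List.Base using (List; length; filter; upTo)
open import Data.List.Relation.Unary.All using (All)
open import Data.List.Relation.Unary.Any using (Any)
open import Data.Nat.Base using (ℕ; suc; _+_; _*_; _^_; _≤_; _<_)
open import Data.Product.Base using (∃; ∃-syntax; _×_)
open import Data.Rational.Base as ℚ using (ℚ; 0ℚ; _/_)
open import Function.Bundles using (_↔_)
open import Function.Properties.Inverse using (↔⇒↣)
open import Level using (Level; 0ℓ; _⊔_)
open import Relation.Binary.Core using (Rel)
open import Relation.Binary.Definitions using (DecidableEquality)
open import Relation.Binary.PropositionalEquality using (_≡_; _≢_; _≗_)
open import Relation.Unary using (Pred; Decidable)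
open import Relation.Unary.Properties using (∁?)

private
  variable
    a p r : Level

-- log k / log l ∉ ℚ.  For k, l ≥ 2 the quotient is positive, and it equals
-- s / t with t ≥ 1 exactly when k ^ t ≡ l ^ s.
MultiplicativelyIndependent : ℕ → ℕ → Set
MultiplicativelyIndependent k l = ∀ s t → 1 ≤ t → k ^ t ≢ l ^ s

IsLimSup : (ℕ → ℚ) → ℚ → Set
IsLimSup x L = ∀ ε → 0ℚ ℚ.< ε →
  (∃[ N₀ ] ∀ N → N₀ ≤ N → x N ℚ.< L ℚ.+ ε) ×
  (∀ N₀ → ∃[ N ] N₀ ≤ N × L ℚ.- ε ℚ.< x N)

-- |A ∩ {0, …, N-1}|
count : {A : Pred ℕ p} → Decidable A → ℕ → ℕ
count A? N = length (filter A? (upTo N))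

-- limsup |A ∩ {0, …, N-1}| / N = d, the sequence being indexed from N = 1 so
-- that the quotient makes sense.  Only rational values d can be expressed.
HasUpperDensity : {A : Pred ℕ p} → Decidable A → ℚ → Set
HasUpperDensity A? = IsLimSup (λ N → + count A? (suc N) / suc N)

ForAlmostAll : {P : Pred ℕ p} → Decidable P → Set
ForAlmostAll P? = HasUpperDensity (∁? P?) 0ℚ

-- Finiteness, up to _∼_, of a set of elements of A: finitely many of its
-- members represent all ∼-classes meeting it.
FiniteModulo : {A : Set a} → Rel A r → Pred A p → Set (a ⊔ r ⊔ p)
FiniteModulo {A = A} _∼_ P =
  ∃[ xs ] All P xs × (∀ (x : A) → P x → Any (x ∼_) xs)

-- Sequences are identified when they agree pointwise.
Kernel : {Ω : Set a} → ℕ → (ℕ → Ω) → Pred (ℕ → Ω) a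
Kernel k f g = ∃[ α ] ∃[ r ] r < k ^ α × g ≗ (λ n → f (k ^ α * n + r))

Automatic : {Ω : Set a} → ℕ → (ℕ → Ω) → Set a
Automatic k f = FiniteModulo _≗_ (Kernel k f)

Periodic : {Ω : Set a} → (ℕ → Ω) → Set a
Periodic f = ∃[ t ] 1 ≤ t × (∀ n → f (n + t) ≡ f n)

-- Equality on Ω has to be decidable for the disagreements of two sequences to
-- be counted; for finite Ω it is.
finite⇒≟ : {Ω : Set a} {m : ℕ} → Ω ↔ Fin m → DecidableEquality Ω
finite⇒≟ Ω↔Fin = inj⇒≟ (↔⇒↣ Ω↔Fin)

module Asymptotic {Ω : Set a} (_≟_ : DecidableEquality Ω) where

  infix 4 _≃_

  _≃_ : Rel (ℕ → Ω) 0ℓ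
  f ≃ g = ForAlmostAll (λ n → f n ≟ g n)

  AsymptoticallyAutomatic : ℕ → (ℕ → Ω) → Set a
  AsymptoticallyAutomatic l f = FiniteModulo _≃_ (Kernel l f)

{-# OPTIONS --safe #-}

-- Let W : ℕ → Fin Q collect the values of the k-kernel of f at all A n + e with
-- A and e bounded.  W is computed by an automaton reading base-k digits, and if
-- W m = W m′ then f agrees on the blocks m kᵝ + r and m′ kᵝ + r; if m and m′ avoid
-- a null set it also agrees on the blocks m lᵅ + r and m′ lᵅ + r, since the
-- l-kernel has finitely many representatives up to null sets.
--
-- Pass to a power K of k for which a letter c ≠ 0 acts idempotently and all
-- states that can be reached after it can be reached from one another.  By
-- independence there are powers lᵅ < Kᵝ with small difference Δ compared with
-- Kᵝ.  If W (n + i) = W (n + j) and W (m + i) = W (m + j) for n / m = lᵅ / Kᵝ,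
-- the two block shifts (j - i) Kᵝ and (j - i) lᵅ combine to the period (j - i) Δ
-- of f on a block.  Recurrence carries the period to the whole cone of numbers
-- whose expansion starts with that of n₀, for every n₀ ending in c; the common
-- multiple P of the periods does not depend on n₀.
--
-- For every residue ρ the l-kernel provides b ≥ 1 such that x ↦ lᵇ x relates
-- f (lᵅ x + ρ) to f (lᵅ⁺ᵇ x + ρ) off a null set.  As the ratios lᵇʲ / Kⁱ are dense,
-- such a dilation maps part of one cone into any other, and with x a multiple of
-- P this shows that f takes the same value at ρ modulo P in both cones.  The
-- numbers in no cone have no digit c beyond a fixed position, a null set.
module Submission where

open import Data.Bool.Base using (Bool; true; false; not; if_then_else_; _∧_; _∨_)
open import Data.Bool.Properties as Bool using (∨-conicalˡ; ∨-conicalʳ)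
open import Data.Fin.Base using (Fin; toℕ; fromℕ<; combine; remQuot; finToFun; funToFin)
open import Data.Fin.Properties using (pigeonhole; toℕ<n; toℕ-fromℕ<; fromℕ<-cong; combine-injective; remQuot-combine; finToFun-funToFin; any?)
  renaming (_≟_ to _≟ᶠ_)
open import Data.Integer.Base as ℤ using (+<+)
open import Data.Integer.Properties using (drop‿+<+; pos-*)
open import Data.List.Base using (List; []; _∷_; _++_; length; lookup; take; drop; filter; upTo; allFin)
open import Data.List.Membership.Propositional.Properties using (∈-allFin; ∈-lookup)
open import Data.List.Properties using (length-++; length-take; length-drop; take++drop≡id; ++-assoc; filter-++; upTo-∷ʳ)
open import Data.List.Relation.Unary.All as All using (All; []; _∷_)
open import Data.List.Relation.Unary.Any using (index)
open import Data.List.Relation.Unary.Any.Properties using (lookup-index)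
open import Data.Nat.Base
open import Data.Nat.DivMod using (_/_; _%_; m≡m%n+[m/n]*n; m%n<n; [m+kn]%n≡m%n; [m+n]%n≡m%n; m<n⇒m%n≡m; m%n%n≡m%n; %-distribˡ-+; %-distribˡ-*)
open import Data.Nat.Divisibility using (_∣_; divides; n∣m*n; m∣m*n; ∣-trans)
open import Data.Nat.Induction using (<-wellFounded)
open import Data.Nat.Properties
open import Data.Nat.Tactic.RingSolver using (solve-∀)
open import Data.Product.Base using (∃-syntax; _×_; _,_; proj₁; proj₂)
open import Data.Rational.Base as ℚ using (mkℚ; 0ℚ; toℚᵘ; *<*) renaming (_/_ to _/ℚ_)
open import Data.Rational.Properties as ℚ using (toℚᵘ-mono-<; toℚᵘ-cancel-<; toℚᵘ-fromℚᵘ; nonNegative⁻¹; normalize-nonNeg; neg-antimono-<)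
open import Data.Rational.Unnormalised.Base as ℚᵘ using (mkℚᵘ)
open import Data.Rational.Unnormalised.Properties as ℚᵘ using (<-respˡ-≃; ≃-sym; drop-*<*)
open import Data.Sum.Base using (_⊎_; inj₁; inj₂; [_,_]′)
open import Function.Base using (_∘_; case_of_)
open import Function.Bundles using (_↔_; Inverse; Injection)
open import Function.Properties.Inverse using (↔⇒↣)
open import Induction.WellFounded using (Acc; acc)
open import Relation.Binary.Definitions using (DecidableEquality; tri<; tri≈; tri>)
open import Relation.Binary.PropositionalEquality
open import Relation.Nullary using (¬_; Dec; yes; no; does; contradiction)
open import Relation.Nullary.Decidable using (dec-true; dec-false; map′; _×-dec_; _⊎-dec_; ¬?; decidable-stable)
open import Relation.Unary using (Pred; Decidable)
open import Relation.Unary.Properties using (∁?)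
open import Defs

-- Powers of multiplicatively independent integers

-- A linear consequence p ≤ q ⊢ a ≤ b, with the slack s of the difference; the
-- equation can be left to the ring solver.
linear : ∀ {a b p q} s → p ≤ q → a + q + s ≡ b + p → a ≤ b
linear {a} {b} {p} {q} s p≤q eq = +-cancelʳ-≤ q a b (begin
  a + q      ≤⟨ m≤m+n (a + q) s ⟩
  a + q + s  ≡⟨ eq ⟩
  b + p      ≤⟨ +-monoʳ-≤ b p≤q ⟩
  b + q      ∎)
  where open ≤-Reasoning

≥2⇒nonZero : ∀ {a} → 2 ≤ a → NonZero a
≥2⇒nonZero (s≤s _) = _

1≤^ : ∀ a n → 1 ≤ a → 1 ≤ a ^ n
1≤^ a n 1≤a = m^n>0 a {{>-nonZero 1≤a}} n

n<^n : ∀ {a} → 2 ≤ a → ∀ n → n < a ^ n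
n<^n 2≤a zero = s≤s z≤n
n<^n {a} 2≤a (suc n) = begin
  2 + n        ≤⟨ linear n (*-monoʳ-≤ 2 (n<^n 2≤a n)) (eq n (a ^ n)) ⟩
  2 * a ^ n    ≤⟨ *-monoˡ-≤ (a ^ n) 2≤a ⟩
  a * a ^ n    ∎
  where
  open ≤-Reasoning
  eq : ∀ n x → 2 + n + 2 * x + n ≡ 2 * x + 2 * suc n
  eq = solve-∀

pigeonhole-ℕ : ∀ {n} (f : ℕ → Fin n) → ∃[ i ] ∃[ j ] i < j × j ≤ n × f i ≡ f j
pigeonhole-ℕ f with pigeonhole ≤-refl (f ∘ toℕ)
... | i , j , i<j , eq = toℕ i , toℕ j , i<j , s≤s⁻¹ (toℕ<n j) , eq

-- Takes the place of logarithms: it locates the exponent at which a comparison of powers flips.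
crossing : ∀ {ℓ} {P : Pred ℕ ℓ} → Decidable P → ∀ n → P 0 → ¬ P n →
  ∃[ i ] i < n × P i × ¬ P (suc i)
crossing P? zero P0 ¬Pn = contradiction P0 ¬Pn
crossing P? (suc n) P0 ¬Pn with P? n
... | yes Pn = n , ≤-refl , Pn , ¬Pn
... | no ¬P with crossing P? n P0 ¬P
... | i , i<n , Pi , ¬Pi+1 = i , m<n⇒m<1+n i<n , Pi , ¬Pi+1

^-cancel-< : ∀ a → 1 ≤ a → ∀ {m n} → a ^ m < a ^ n → m < n
^-cancel-< a 1≤a {m} {n} h = ≰⇒> λ n≤m →
  <⇒≱ h (^-monoʳ-≤ a {{>-nonZero 1≤a}} n≤m)

-- Bernoulli's inequality (1 + 1/h)ˢ ≥ 1 + s/h, cleared of denominators.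
bernoulli : ∀ {h g} → h < g → ∀ s → (h + s) * h ^ s ≤ h * g ^ s
bernoulli {h} {g} h<g zero = ≤-reflexive (cong (_* 1) (+-identityʳ h))
bernoulli {h} {g} h<g (suc s) = begin
  (h + suc s) * (h * h ^ s)
    ≤⟨ linear (s * h ^ s) (*-monoʳ-≤ (suc h) (bernoulli h<g s)) (eq h s (h ^ s) (g ^ s)) ⟩
  h * (suc h * g ^ s)
    ≤⟨ *-monoʳ-≤ h (*-monoˡ-≤ (g ^ s) h<g) ⟩
  h * (g * g ^ s) ∎
  where
  open ≤-Reasoning
  eq : ∀ h s x y → (h + suc s) * (h * x) + suc h * (h * y) + s * x ≡
                   h * (suc h * y) + suc h * ((h + s) * x)
  eq = solve-∀

-- With `s = C * h` the factor `h + s` in Bernoulli's inequality is at least `C * h`.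
^-gap : ∀ {h g} → h < g → ∀ C → ∃[ s ] C * h ^ s ≤ g ^ s
^-gap {zero} h<g C = 1 , ≤-trans (≤-reflexive (*-zeroʳ C)) z≤n
^-gap h@{suc _} {g} h<g C = C * h , *-cancelˡ-≤ h (begin
  h * (C * h ^ (C * h))          ≡⟨ eq h C _ ⟩
  C * h * h ^ (C * h)            ≤⟨ *-monoˡ-≤ (h ^ (C * h)) (m≤n+m (C * h) h) ⟩
  (h + C * h) * h ^ (C * h)      ≤⟨ bernoulli h<g (C * h) ⟩
  h * g ^ (C * h)                ∎)
  where
  open ≤-Reasoning
  eq : ∀ h C x → h * (C * x) ≡ C * h * x
  eq = solve-∀

-- The definition asks for a positive exponent on its first base only, so the other exponent must be
-- shown positive before the roles change.
independent-sym : ∀ {x y} → 2 ≤ x → 2 ≤ y →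
  MultiplicativelyIndependent x y → MultiplicativelyIndependent y x
independent-sym {x} {y} 2≤x 2≤y ind s (suc t) _ eq =
  case m≤n⇒m<n∨m≡n (z≤n {s}) of λ where
    (inj₁ 1≤s) → ind (suc t) s 1≤s (sym eq)
    (inj₂ refl) → <⇒≢ (^-monoʳ-< y 2≤y {0} {suc t} (s≤s z≤n)) (sym eq)

-- The pair (e , d) makes y ^ d / x ^ e lie in (1 , 1 + 1/N].
CloseAbove : ℕ → ℕ → ℕ → Set
CloseAbove x y N = ∃[ e ] ∃[ d ] x ^ e < y ^ d × N * y ^ d ≤ suc N * x ^ e

bounded-below : ∀ x y → 2 ≤ x → 1 ≤ y → ∃[ p ] x ^ p ≤ y × y < x ^ suc p
bounded-below x y 2≤x 1≤y =
  let p , _ , le , nle = crossing (λ p → x ^ p ≤? y) y 1≤y (<⇒≱ (n<^n 2≤x y))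
  in p , le , ≰⇒> nle

CloseTo : ℕ → ℕ → ℕ → Set
CloseTo N u v = N * u ≤ suc N * v × N * v ≤ suc N * u

-- A pair of powers in ratio u/v = yⁱ/xᵖ ∈ [((N+1)/N)ʲ , ((N+1)/N)ʲ⁺¹).
InBin : ℕ → ℕ → ℕ → ℕ → Set
InBin N j u v = suc N ^ j * v ≤ N ^ j * u × N ^ suc j * u < suc N ^ suc j * v

-- The lower bound for the first pair times the upper bound for the second contains the factor
-- `N ^ j * suc N ^ j`, which cancels.
bins-close : ∀ N j {u v u′ v′} → 1 ≤ N → InBin N j u v → InBin N j u′ v′ →
  N * (u′ * v) ≤ suc N * (u * v′)
bins-close N j {u} {v} {u′} {v′} 1≤N (lo , _) (_ , hi) =
  *-cancelˡ-≤ (N ^ j * suc N ^ j) {{m*n≢0 (N ^ j) (suc N ^ j) {{m^n≢0 N j {{>-nonZero 1≤N}}}} {{m^n≢0 (suc N) j}}}}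
    (subst₂ _≤_ (eq₁ (N ^ j) (suc N ^ j) N u′ v) (eq₂ (N ^ j) (suc N ^ j) N u v′)
      (*-mono-≤ (<⇒≤ hi) lo))
  where
  eq₁ : ∀ a b N u′ v → N * a * u′ * (b * v) ≡ a * b * (N * (u′ * v))
  eq₁ = solve-∀
  eq₂ : ∀ a b N u v′ → suc N * b * v′ * (a * u) ≡ a * b * (suc N * (u * v′))
  eq₂ = solve-∀

module _ {x y} (2≤x : 2 ≤ x) (2≤y : 2 ≤ y) (ind : MultiplicativelyIndependent x y)
         (N : ℕ) (1≤N : 1 ≤ N) where

  private instance
    x≢0 : NonZero x
    x≢0 = ≥2⇒nonZero 2≤x
    y≢0 : NonZero y
    y≢0 = ≥2⇒nonZero 2≤y
    N≢0 : NonZero N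
    N≢0 = >-nonZero 1≤N

  private
    powers : ∀ i → ∃[ p ] x ^ p ≤ y ^ i × y ^ i < x ^ suc p
    powers i = bounded-below x (y ^ i) 2≤x (1≤^ y i (<⇒≤ 2≤y))

    -- The ratio `y ^ i / x ^ p` lies in `[1 , x)` and `((N + 1) / N) ^ M` is at least `x`, so `M`
    -- bins suffice.
    gap = ^-gap (≤-refl {suc N}) x
    M = proj₁ gap

    bin : ∀ i → ∃[ j ] j < M × InBin N j (y ^ i) (x ^ proj₁ (powers i))
    bin i = let p , lo , hi = powers i in
      let j , j<M , le , nle = crossing (λ j → suc N ^ j * x ^ p ≤? N ^ j * y ^ i) M
            (*-monoʳ-≤ 1 lo)
            (λ le → <-irrefl refl (begin-strict
              suc N ^ M * x ^ p    ≤⟨ le ⟩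
              N ^ M * y ^ i        <⟨ *-monoʳ-< (N ^ M) {{m^n≢0 N M}} hi ⟩
              N ^ M * (x * x ^ p)  ≡⟨ eq (N ^ M) x (x ^ p) ⟩
              x * N ^ M * x ^ p    ≤⟨ *-monoˡ-≤ (x ^ p) (proj₂ gap) ⟩
              suc N ^ M * x ^ p    ∎))
      in j , j<M , le , ≰⇒> nle
      where
      open ≤-Reasoning
      eq : ∀ a x b → a * (x * b) ≡ x * a * b
      eq = solve-∀

  -- Dirichlet's argument: two powers of `y` fall into the same bin, and their quotient is close to
  -- a power of `x`.
  close-powers : ∃[ e ] ∃[ d ] 1 ≤ d × CloseTo N (y ^ d) (x ^ e)
  close-powers =
    let i , i′ , i<i′ , _ , eq = pigeonhole-ℕ (λ i → fromℕ< (proj₁ (proj₂ (bin i))))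
        j , j<M , b = bin i
        j′ , j′<M , b′ = bin i′
        p , lo , _ = powers i
        p′ , _ , hi′ = powers i′
        j≡j′ : j ≡ j′
        j≡j′ = trans (sym (toℕ-fromℕ< j<M)) (trans (cong toℕ eq) (toℕ-fromℕ< j′<M))
        b″ : InBin N j (y ^ i′) (x ^ p′)
        b″ = subst (λ j → InBin N j (y ^ i′) (x ^ p′)) (sym j≡j′) b′
        p≤p′ : p ≤ p′
        p≤p′ = s≤s⁻¹ (^-cancel-< x (<⇒≤ 2≤x)
                 (≤-<-trans (≤-trans lo (^-monoʳ-≤ y (<⇒≤ i<i′))) hi′))
        split : ∀ (z : ℕ) {m n} → m ≤ n → z ^ n ≡ z ^ m * z ^ (n ∸ m)
        split z {m} {n} m≤n = trans (cong (z ^_) (sym (m+[n∸m]≡n m≤n))) (^-distribˡ-+-* z m (n ∸ m))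
        u = y ^ i
        v = x ^ p
        u≢0 : NonZero (u * v)
        u≢0 = m*n≢0 u v {{m^n≢0 y i}} {{m^n≢0 x p}}
    in p′ ∸ p , i′ ∸ i , m<n⇒0<n∸m i<i′ ,
       *-cancelˡ-≤ (u * v) {{u≢0}} (subst₂ _≤_
         (trans (cong (λ t → N * (t * v)) (split y (<⇒≤ i<i′))) (eq₁ u v _ N))
         (trans (cong (λ t → suc N * (u * t)) (split x p≤p′)) (eq₃ u v _ N))
         (bins-close N j 1≤N b b″)) ,
       *-cancelˡ-≤ (u * v) {{u≢0}} (subst₂ _≤_
         (trans (cong (λ t → N * (u * t)) (split x p≤p′)) (eq₂ u v _ N))
         (trans (cong (λ t → suc N * (t * v)) (split y (<⇒≤ i<i′))) (eq₄ u v _ N))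
         (bins-close N j 1≤N b″ b))
    where
    eq₁ : ∀ u v w N → N * (u * w * v) ≡ u * v * (N * w)
    eq₁ = solve-∀
    eq₂ : ∀ u v w N → N * (u * (v * w)) ≡ u * v * (N * w)
    eq₂ = solve-∀
    eq₃ : ∀ u v w N → suc N * (u * (v * w)) ≡ u * v * (suc N * w)
    eq₃ = solve-∀
    eq₄ : ∀ u v w N → suc N * (u * w * v) ≡ u * v * (suc N * w)
    eq₄ = solve-∀

  -- If x ^ e / y ^ d lies slightly above 1, its powers pass x by a step which
  -- is just as small: x / (x ^ e / y ^ d) ^ s is the ratio sought.
  flip-close : ∀ e d → 1 ≤ d → y ^ d < x ^ e → N * x ^ e ≤ suc N * y ^ d →
    CloseAbove x y N
  flip-close zero d _ lt _ = contradiction lt (≤⇒≯ (1≤^ y d (<⇒≤ 2≤y)))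
  flip-close (suc e) d 1≤d lt close =
    let t , big = ^-gap lt (suc x)
        s , _ , le , nle = crossing (λ s → (x ^ suc e) ^ s ≤? x * (y ^ d) ^ s) t
          (≤-trans (<⇒≤ 2≤x) (≤-reflexive (sym (*-identityʳ x))))
          (λ le → <⇒≱ (*-monoˡ-< ((y ^ d) ^ t) {{m^n≢0 (y ^ d) t {{m^n≢0 y d}}}} (n<1+n x))
            (≤-trans big le))
    in go s le (≰⇒> nle)
    where
    open ≤-Reasoning
    A = x ^ suc e
    B = y ^ d
    go : ∀ s → A ^ s ≤ x * B ^ s → x * B ^ suc s < A ^ suc s → CloseAbove x y N
    -- The first step cannot pass `x`, because `A / B` is at most `(N + 1) / N ≤ 2 ≤ x`.
    go zero le lt′ = contradiction (begin-strict
      N * x * B          ≡⟨ *-assoc N x B ⟩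
      N * (x * B)        ≡⟨ cong (λ b → N * (x * b)) (sym (*-identityʳ B)) ⟩
      N * (x * (B * 1))  <⟨ *-monoʳ-< N lt′ ⟩
      N * (A * 1)        ≡⟨ cong (N *_) (*-identityʳ A) ⟩
      N * A              ≤⟨ close ⟩
      suc N * B          ≤⟨ *-monoˡ-≤ B (begin
        1 + N            ≤⟨ +-monoˡ-≤ N 1≤N ⟩
        N + N            ≡⟨ cong (N +_) (sym (+-identityʳ N)) ⟩
        2 * N            ≡⟨ *-comm 2 N ⟩
        N * 2            ≤⟨ *-monoʳ-≤ N 2≤x ⟩
        N * x            ∎) ⟩
      N * x * B          ∎) (<-irrefl refl)
    go (suc s) le lt′ = m , d * suc s , ≤∧≢⇒< below above , near
      where
      -- `x ^ m` is `A ^ suc s` with one factor `x` removed.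
      m = s + e * suc s
      A^ : A ^ suc s ≡ x * x ^ m
      A^ = ^-*-assoc x (suc e) (suc s)
      B^ : B ^ suc s ≡ y ^ (d * suc s)
      B^ = ^-*-assoc y d (suc s)
      below : x ^ m ≤ y ^ (d * suc s)
      below = *-cancelˡ-≤ x (begin
        x * x ^ m  ≡⟨ sym A^ ⟩
        A ^ suc s  ≤⟨ le ⟩
        x * B ^ suc s ≡⟨ cong (x *_) B^ ⟩
        x * y ^ (d * suc s) ∎)
      above : x ^ m ≢ y ^ (d * suc s)
      above eq = independent-sym 2≤x 2≤y ind m (d * suc s)
        (*-mono-≤ 1≤d (s≤s {0} {s} z≤n)) (sym eq)
      near : N * y ^ (d * suc s) ≤ suc N * x ^ m
      near = *-cancelˡ-≤ x (*-cancelˡ-≤ B {{m^n≢0 y d}} (begin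
        B * (x * (N * y ^ (d * suc s))) ≡⟨ cong (λ t → B * (x * (N * t))) (sym B^) ⟩
        B * (x * (N * B ^ suc s))       ≡⟨ eq₁ B x N (B ^ suc s) ⟩
        N * (x * B ^ suc (suc s))       ≤⟨ *-monoʳ-≤ N (<⇒≤ lt′) ⟩
        N * (A * A ^ suc s)             ≡⟨ sym (*-assoc N A _) ⟩
        N * A * A ^ suc s               ≤⟨ *-monoˡ-≤ (A ^ suc s) close ⟩
        suc N * B * A ^ suc s           ≡⟨ cong (suc N * B *_) A^ ⟩
        suc N * B * (x * x ^ m)         ≡⟨ eq₂ (suc N) B x (x ^ m) ⟩
        B * (x * (suc N * x ^ m))       ∎))
        where
        eq₁ : ∀ B x N t → B * (x * (N * t)) ≡ N * (x * (B * t))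
        eq₁ = solve-∀
        eq₂ : ∀ n B x t → n * B * (x * t) ≡ B * (x * (n * t))
        eq₂ = solve-∀

  opaque
    close-above : CloseAbove x y N
    close-above =
      let e , d , 1≤d , near , near′ = close-powers in
      case <-cmp (x ^ e) (y ^ d) of λ where
        (tri< lt _ _) → e , d , lt , near
        (tri≈ _ eq _) → contradiction (sym eq) (independent-sym 2≤x 2≤y ind e d 1≤d)
        (tri> _ _ gt) → flip-close e d 1≤d gt near′

-- Sets of density zero

bit : Bool → ℕ
bit b = if b then 1 else 0

cnt : (ℕ → Bool) → ℕ → ℕ
cnt χ zero = 0
cnt χ (suc n) = bit (χ n) + cnt χ n

infix 4 _⊑_
_⊑_ : (ℕ → Bool) → (ℕ → Bool) → Set
χ ⊑ ψ = ∀ n → χ n ≡ true → ψ n ≡ true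

bit≤1 : ∀ b → bit b ≤ 1
bit≤1 false = z≤n
bit≤1 true = s≤s z≤n

bit-mono : ∀ b c → (b ≡ true → c ≡ true) → bit b ≤ bit c
bit-mono false c h = z≤n
bit-mono true c h = ≤-reflexive (sym (cong bit (h refl)))

cnt-mono : ∀ {χ ψ} → χ ⊑ ψ → ∀ n → cnt χ n ≤ cnt ψ n
cnt-mono h zero = z≤n
cnt-mono h (suc n) = +-mono-≤ (bit-mono _ _ (h n)) (cnt-mono h n)

cnt-monoʳ : ∀ χ {m n} → m ≤ n → cnt χ m ≤ cnt χ n
cnt-monoʳ χ {m} {zero} z≤n = z≤n
cnt-monoʳ χ {m} {suc n} m≤1+n = case m≤n⇒m<n∨m≡n m≤1+n of λ where
  (inj₁ m<1+n) → ≤-trans (cnt-monoʳ χ (s≤s⁻¹ m<1+n)) (m≤n+m (cnt χ n) (bit (χ n)))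
  (inj₂ refl) → ≤-refl

cnt-hit : ∀ χ {m n} → m < n → χ m ≡ true → suc (cnt χ m) ≤ cnt χ n
cnt-hit χ {m} m<n hit = ≤-trans
  (≤-reflexive (cong (λ b → bit b + cnt χ m) (sym hit))) (cnt-monoʳ χ m<n)

cnt≤n : ∀ χ n → cnt χ n ≤ n
cnt≤n χ zero = z≤n
cnt≤n χ (suc n) = +-mono-≤ (bit≤1 (χ n)) (cnt≤n χ n)

cnt-∨ : ∀ χ ψ n → cnt (λ x → χ x ∨ ψ x) n ≤ cnt χ n + cnt ψ n
cnt-∨ χ ψ zero = z≤n
cnt-∨ χ ψ (suc n) = ≤-trans (+-mono-≤ (bit-∨ (χ n) (ψ n)) (cnt-∨ χ ψ n))
  (≤-reflexive (eq (bit (χ n)) (bit (ψ n)) (cnt χ n) (cnt ψ n)))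
  where
  bit-∨ : ∀ b c → bit (b ∨ c) ≤ bit b + bit c
  bit-∨ true c = s≤s z≤n
  bit-∨ false c = ≤-refl
  eq : ∀ a b c d → a + b + (c + d) ≡ a + c + (b + d)
  eq = solve-∀

cnt-∘ : ∀ χ (g : ℕ → ℕ) → (∀ n → g n < g (suc n)) → ∀ n → cnt (χ ∘ g) n ≤ cnt χ (g n)
cnt-∘ χ g g< zero = z≤n
cnt-∘ χ g g< (suc n) = ≤-trans (+-monoʳ-≤ (bit (χ (g n))) (cnt-∘ χ g g< n)) (cnt-monoʳ χ (g< n))

-- Density zero, cleared of denominators: the proportion is eventually at most `1 / M` for every
-- `M`.
Null : (ℕ → Bool) → Set
Null χ = ∀ M → ∃[ N₀ ] ∀ N → N₀ ≤ N → M * cnt χ N ≤ N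

null-∅ : Null (λ _ → false)
null-∅ M = 0 , λ N _ → ≤-trans (≤-reflexive (trans (cong (M *_) (zero-cnt N)) (*-zeroʳ M))) z≤n
  where
  zero-cnt : ∀ N → cnt (λ _ → false) N ≡ 0
  zero-cnt zero = refl
  zero-cnt (suc N) = zero-cnt N

null-∨ : ∀ {χ ψ} → Null χ → Null ψ → Null (λ n → χ n ∨ ψ n)
null-∨ {χ} {ψ} nχ nψ M =
  let N₁ , b₁ = nχ (2 * M)
      N₂ , b₂ = nψ (2 * M)
  in N₁ ⊔ N₂ , λ N N≥ → *-cancelˡ-≤ 2 (begin
    2 * (M * cnt (λ n → χ n ∨ ψ n) N)  ≤⟨ *-monoʳ-≤ 2 (*-monoʳ-≤ M (cnt-∨ χ ψ N)) ⟩
    2 * (M * (cnt χ N + cnt ψ N))      ≡⟨ eq M (cnt χ N) (cnt ψ N) ⟩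
    2 * M * cnt χ N + 2 * M * cnt ψ N  ≤⟨ +-mono-≤ (b₁ N (m⊔n≤o⇒m≤o N₁ N₂ N≥)) (b₂ N (m⊔n≤o⇒n≤o N₁ N₂ N≥)) ⟩
    N + N                              ≡⟨ cong (N +_) (sym (+-identityʳ N)) ⟩
    2 * N ∎)
  where
  open ≤-Reasoning
  eq : ∀ M a b → 2 * (M * (a + b)) ≡ 2 * M * a + 2 * M * b
  eq = solve-∀

-- Hits of the preimage below `N` are hits of `χ` below `X * N + q`, and this is at most
-- `(X + q) * N` once `N` is positive.
null-affine : ∀ {χ} X q → 1 ≤ X → Null χ → Null (λ n → χ (X * n + q))
null-affine {χ} X q 1≤X null M =
  let N₀ , b = null (M * (X + q)) in
  N₀ ⊔ 1 , λ N N≥ →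
    let 1≤N = m⊔n≤o⇒n≤o N₀ 1 N≥
        g = λ n → X * n + q
        instance X+q≢0 = >-nonZero (≤-trans 1≤X (m≤m+n X q))
    in *-cancelˡ-≤ (X + q) (begin
      (X + q) * (M * cnt (χ ∘ g) N)  ≤⟨ *-monoʳ-≤ (X + q) (*-monoʳ-≤ M (cnt-∘ χ g (λ n → +-monoˡ-< q (*-monoʳ-< X {{>-nonZero 1≤X}} (n<1+n n))) N)) ⟩
      (X + q) * (M * cnt χ (g N))    ≡⟨ eq (X + q) M (cnt χ (g N)) ⟩
      M * (X + q) * cnt χ (g N)      ≤⟨ b (g N) (≤-trans (m⊔n≤o⇒m≤o N₀ 1 N≥) (≤-trans (m≤n*m N X {{>-nonZero 1≤X}}) (m≤m+n (X * N) q))) ⟩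
      X * N + q                      ≤⟨ +-monoʳ-≤ (X * N) (m≤m*n q N {{>-nonZero 1≤N}}) ⟩
      X * N + q * N                  ≡⟨ *-distribʳ-+ N X q ⟨
      (X + q) * N                    ∎)
  where
  open ≤-Reasoning
  eq : ∀ a b c → a * (b * c) ≡ b * a * c
  eq = solve-∀

⋃ : ℕ → (ℕ → ℕ → Bool) → ℕ → Bool
⋃ zero χ x = false
⋃ (suc n) χ x = χ n x ∨ ⋃ n χ x

null-⋃ : ∀ n {χ} → (∀ i → i < n → Null (χ i)) → Null (⋃ n χ)
null-⋃ zero nulls = null-∅
null-⋃ (suc n) nulls = null-∨ (nulls n ≤-refl) (null-⋃ n λ i i<n → nulls i (m<n⇒m<1+n i<n))

∉⋃ : ∀ n {χ x} → ⋃ n χ x ≡ false → ∀ {i} → i < n → χ i x ≡ false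
∉⋃ (suc n) {χ} {x} out {i} i<1+n = case m≤n⇒m<n∨m≡n (s≤s⁻¹ i<1+n) of λ where
  (inj₁ i<n) → ∉⋃ n (∨-conicalʳ (χ n x) _ out) i<n
  (inj₂ refl) → ∨-conicalˡ (χ n x) _ out

-- The numbers whose base-K expansion extends the one of n by J digits.
Cone : ℕ → ℕ → ℕ → ℕ → Set
Cone K n J z = n * K ^ J ≤ z × z < suc n * K ^ J

divide : ∀ X .{{_ : NonZero X}} y → ∃[ q ] X * q ≤ y × y < X * suc q
divide X y = y / X ,
  ≤-trans (≤-reflexive (*-comm X _)) (≤-trans (m≤n+m _ (y % X)) (≤-reflexive (sym (m≡m%n+[m/n]*n y X)))) ,
  ≤-trans (s≤s (≤-reflexive (m≡m%n+[m/n]*n y X)))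
    (≤-trans (+-monoˡ-≤ (y / X * X) (m%n<n y X)) (≤-reflexive (*-comm (suc (y / X)) X)))

module _ (χ : ℕ → Bool) (M : ℕ) where

  -- The search for a period needs many offsets outside the null set at once; the comparison of
  -- cones uses offset 0 only.
  FreeWindow : ℕ → Set
  FreeWindow x = ∀ i → i < M → χ (M * x + i) ≡ false

  free-or-hit : ∀ x → FreeWindow x ⊎ ∃[ i ] i < M × χ (M * x + i) ≡ true
  free-or-hit x with anyUpTo? (λ i → χ (M * x + i) Bool.≟ true) M
  ... | yes (i , i<M , hit) = inj₂ (i , i<M , hit)
  ... | no ¬hit = inj₁ λ i i<M → Bool.¬-not (λ hit → ¬hit (i , i<M , hit))

  -- Windows are disjoint, so each one that meets `χ` adds a new hit to the count.
  free-window : ∀ x₀ L →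
    (∃[ x ] x₀ ≤ x × x < x₀ + L × FreeWindow x) ⊎ L ≤ cnt χ (M * (x₀ + L))
  free-window x₀ zero = inj₂ z≤n
  free-window x₀ (suc L) = [ earlier , [ here , later ]′ ∘ counted ]′ (free-window x₀ L)
    where
    counted : L ≤ cnt χ (M * (x₀ + L)) → _ ⊎ _
    counted many = [ inj₁ , (λ hit → inj₂ (many , hit)) ]′ (free-or-hit (x₀ + L))
    earlier = λ (x , x₀≤x , x< , free) →
      inj₁ (x , x₀≤x , ≤-trans x< (+-monoʳ-≤ x₀ (n≤1+n L)) , free)
    here = λ free → inj₁ (x₀ + L , m≤m+n x₀ L , +-monoʳ-< x₀ (n<1+n L) , free)
    later = λ (many , i , i<M , hit) → inj₂ (≤-trans (s≤s (≤-trans many (cnt-monoʳ χ (m≤m+n (M * (x₀ + L)) i))))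
      (cnt-hit χ (≤-trans (+-monoʳ-< (M * (x₀ + L)) i<M)
        (≤-reflexive (eq M x₀ L))) hit))
      where
      eq : ∀ M x L → M * (x + L) + M ≡ M * (x + suc L)
      eq = solve-∀

-- If every window of a long range of multiples of M met χ, then χ would have
-- positive density up to the end of that range.
opaque
  free-multiple-in-cone : ∀ {K X M χ} u → 2 ≤ K → 1 ≤ X → 1 ≤ M → Null χ →
    ∃[ x ] ∃[ J ] u * K ^ J ≤ X * x × X * suc x ≤ suc u * K ^ J × FreeWindow χ M x
  free-multiple-in-cone {K} {X} {M} {χ} u 2≤K 1≤X 1≤M null =
    let instance
          X≢0 = >-nonZero 1≤X
        -- The end of the range turns out to be at most `3 * M * suc u` times its number `L` of
        -- windows.
        C = suc (3 * M * suc u)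
        N₀ , bound = null C
        -- As `K ^ J` exceeds `J`, the cone holds enough multiples of `X`: the quotient `q` is at
        -- least `3 + N₀`.
        J = X * (3 + N₀)
        q , Xq≤ , <Xq+ = divide X (K ^ J)
        p , Xp≤ , <Xp+ = divide X (u * K ^ J)
        3+N₀≤q : 3 + N₀ ≤ q
        3+N₀≤q = s≤s⁻¹ (*-cancelˡ-< X (3 + N₀) (suc q) (<-trans (n<^n 2≤K J) <Xq+))
        -- The range starts at `suc p` to clear the lower end of the cone, which leaves room for
        -- `q - 1` candidates below the upper end.
        L = pred q
        q≡ : q ≡ suc L
        q≡ = sym (suc-pred q {{>-nonZero (≤-trans (s≤s z≤n) 3+N₀≤q)}})
        1≤L : 1 ≤ L
        1≤L = s≤s⁻¹ (subst (2 ≤_) q≡ (≤-trans (s≤s (s≤s z≤n)) 3+N₀≤q))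
        p≤ : p ≤ u * suc q
        p≤ = *-cancelˡ-≤ X (≤-trans Xp≤ (≤-trans (*-monoʳ-≤ u (<⇒≤ <Xq+)) (≤-reflexive (eq₁ u X (suc q)))))
        top : X * (suc p + L) ≤ suc u * K ^ J
        top = begin
          X * (suc p + L)      ≡⟨ cong (X *_) (trans (sym (+-suc p L)) (cong (p +_) (sym q≡))) ⟩
          X * (p + q)          ≡⟨ *-distribˡ-+ X p q ⟩
          X * p + X * q        ≤⟨ +-mono-≤ Xp≤ Xq≤ ⟩
          u * K ^ J + K ^ J    ≡⟨ +-comm (u * K ^ J) _ ⟩
          suc u * K ^ J        ∎
        sparse : ¬ (L ≤ cnt χ (M * (suc p + L)))
        sparse many = <⇒≱ (≤-refl {C}) (*-cancelʳ-≤ C (3 * M * suc u) L {{>-nonZero 1≤L}} (begin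
          C * L                           ≤⟨ *-monoʳ-≤ C many ⟩
          C * cnt χ (M * (suc p + L))     ≤⟨ bound _ (begin
            N₀                            ≤⟨ m≤n+m N₀ 3 ⟩
            3 + N₀                        ≤⟨ 3+N₀≤q ⟩
            q                             ≡⟨ q≡ ⟩
            suc L                         ≤⟨ s≤s (m≤n+m L p) ⟩
            suc p + L                     ≤⟨ m≤n*m (suc p + L) M {{>-nonZero 1≤M}} ⟩
            M * (suc p + L)               ∎) ⟩
          M * (suc p + L)                 ≤⟨ *-monoʳ-≤ M (+-monoˡ-≤ L (s≤s (≤-trans p≤ (≤-reflexive (cong (λ t → u * suc t) q≡))))) ⟩
          M * (suc (u * suc (suc L)) + L) ≤⟨ *-monoʳ-≤ M (linear 1 (*-monoʳ-≤ (2 * u + 2) 1≤L) (eq₃ u L)) ⟩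
          M * (3 * suc u * L)             ≡⟨ eq₂ M (suc u) L ⟩
          3 * M * suc u * L ∎))
    in case free-window χ M (suc p) L of λ where
      (inj₁ (x , x₀≤x , x< , free)) → x , J ,
        ≤-trans (<⇒≤ <Xp+) (*-monoʳ-≤ X x₀≤x) , ≤-trans (*-monoʳ-≤ X x<) top , free
      (inj₂ many) → contradiction many sparse
    where
    open ≤-Reasoning
    eq₁ : ∀ u X q → u * (X * q) ≡ X * (u * q)
    eq₁ = solve-∀
    eq₂ : ∀ M u L → M * (3 * u * L) ≡ 3 * M * u * L
    eq₂ = solve-∀
    eq₃ : ∀ u L → suc (u * suc (suc L)) + L + (2 * u + 2) * L + 1 ≡ 3 * suc u * L + (2 * u + 2) * 1
    eq₃ = solve-∀

-- The last digit and the remaining prefix are constrained independently, so the counts multiply.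
cnt-digit : ∀ K (χ β ψ : ℕ → Bool) →
  (∀ n j → j < K → ψ (K * n + j) ≡ (β j ∧ χ n)) → ∀ n → cnt ψ (K * n) ≡ cnt χ n * cnt β K
cnt-digit K χ β ψ spec zero = cong (cnt ψ) (*-zeroʳ K)
cnt-digit K χ β ψ spec (suc n) = trans (cong (cnt ψ) (eq₁ K n))
  (trans (partial K ≤-refl)
  (trans (cong (bit (χ n) * cnt β K +_) (cnt-digit K χ β ψ spec n))
    (sym (*-distribʳ-+ (cnt β K) (bit (χ n)) (cnt χ n)))))
  where
  eq₁ : ∀ K n → K * suc n ≡ K * n + K
  eq₁ = solve-∀
  step : ∀ b c x y → bit (b ∧ c) + (bit c * x + y) ≡ bit c * (bit b + x) + y
  step true true x y = refl
  step true false x y = refl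
  step false true x y = refl
  step false false x y = refl
  partial : ∀ j → j ≤ K → cnt ψ (K * n + j) ≡ bit (χ n) * cnt β j + cnt ψ (K * n)
  partial zero _ = trans (cong (cnt ψ) (+-identityʳ (K * n))) (cong (_+ cnt ψ (K * n)) (sym (*-zeroʳ (bit (χ n)))))
  partial (suc j) j<K = trans (cong (cnt ψ) (+-suc (K * n) j))
    (trans (cong₂ (λ b x → bit b + x) (spec n j j<K) (partial j (<⇒≤ j<K)))
      (step (β j) (χ n) (cnt β j) (cnt ψ (K * n))))

module _ (K c : ℕ) .{{_ : NonZero K}} where

  quot-rem : ∀ n j → j < K → (K * n + j) / K ≡ n × (K * n + j) % K ≡ j
  quot-rem n j j<K = *-cancelʳ-≡ _ n K (+-cancelˡ-≡ j _ _ (trans (cong (_+ y / K * K) (sym rem))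
      (trans (sym (m≡m%n+[m/n]*n y K)) (eq K n j)))) , rem
    where
    y = K * n + j
    eq : ∀ K n j → K * n + j ≡ j + n * K
    eq = solve-∀
    rem : y % K ≡ j
    rem = trans (cong (_% K) (eq K n j)) (trans ([m+kn]%n≡m%n j n K) (m<n⇒m%n≡m j<K))

  -- No digit c at the positions t , … , t + s - 1 of the base-K expansion.
  avoids : ℕ → ℕ → ℕ → Bool
  avoids zero zero y = true
  avoids zero (suc s) y = not (y % K ≡ᵇ c) ∧ avoids zero s (y / K)
  avoids (suc t) s y = avoids t s (y / K)

  ≢c : ℕ → Bool
  ≢c j = not (j ≡ᵇ c)

  -- Each of the `s` constrained positions allows `cnt ≢c K` digits, and each of the `t` positions
  -- below them at most `K`.
  cnt-avoids : ∀ t s n → cnt (avoids t s) (K ^ (t + s) * n) ≤ cnt ≢c K ^ s * K ^ t * n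
  cnt-avoids zero zero n = cnt≤n (λ _ → true) (1 * n)
  cnt-avoids zero (suc s) n = begin
    cnt (avoids 0 (suc s)) (K * K ^ s * n)      ≡⟨ cong (cnt (avoids 0 (suc s))) (*-assoc K (K ^ s) n) ⟩
    cnt (avoids 0 (suc s)) (K * (K ^ s * n))    ≡⟨ cnt-digit K (avoids 0 s) ≢c (avoids 0 (suc s)) spec (K ^ s * n) ⟩
    cnt (avoids 0 s) (K ^ s * n) * cnt ≢c K     ≤⟨ *-monoˡ-≤ (cnt ≢c K) (cnt-avoids 0 s n) ⟩
    cnt ≢c K ^ s * 1 * n * cnt ≢c K             ≡⟨ eq (cnt ≢c K ^ s) n (cnt ≢c K) ⟩
    cnt ≢c K * cnt ≢c K ^ s * 1 * n             ∎
    where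
    open ≤-Reasoning
    eq : ∀ x n d → x * 1 * n * d ≡ d * x * 1 * n
    eq = solve-∀
    spec : ∀ n j → j < K → avoids 0 (suc s) (K * n + j) ≡ (≢c j ∧ avoids 0 s n)
    spec n j j<K = let q , r = quot-rem n j j<K in cong₂ (λ r q → not (r ≡ᵇ c) ∧ avoids 0 s q) r q
  cnt-avoids (suc t) s n = begin
    cnt (avoids (suc t) s) (K * K ^ (t + s) * n)      ≡⟨ cong (cnt (avoids (suc t) s)) (*-assoc K (K ^ (t + s)) n) ⟩
    cnt (avoids (suc t) s) (K * (K ^ (t + s) * n))    ≡⟨ cnt-digit K (avoids t s) (λ _ → true) (avoids (suc t) s) spec (K ^ (t + s) * n) ⟩
    cnt (avoids t s) (K ^ (t + s) * n) * cnt (λ _ → true) K ≤⟨ *-mono-≤ (cnt-avoids t s n) (cnt≤n _ K) ⟩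
    cnt ≢c K ^ s * K ^ t * n * K             ≡⟨ eq (cnt ≢c K ^ s) (K ^ t) n K ⟩
    cnt ≢c K ^ s * (K * K ^ t) * n             ∎
    where
    open ≤-Reasoning
    eq : ∀ x y n d → x * y * n * d ≡ x * (d * y) * n
    eq = solve-∀
    spec : ∀ n j → j < K → avoids (suc t) s (K * n + j) ≡ avoids t s n
    spec n j j<K = cong (avoids t s) (proj₁ (quot-rem n j j<K))

  cnt-≢c : c < K → cnt ≢c K < K
  cnt-≢c = go K
    where
    miss : bit (≢c c) ≡ 0
    miss = cong (bit ∘ not) (dec-true (c ≟ c) refl)
    go : ∀ n → c < n → cnt ≢c n < n
    go (suc n) c<1+n = case m≤n⇒m<n∨m≡n (s≤s⁻¹ c<1+n) of λ where
      (inj₁ c<n) → ≤-trans (s≤s (+-monoˡ-≤ (cnt ≢c n) (bit≤1 (≢c n)))) (s≤s (go n c<n))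
      (inj₂ refl) → s≤s (≤-trans (≤-reflexive (cong (_+ cnt ≢c c) miss)) (cnt≤n ≢c c))

  -- The proportion is about `(cnt ≢c K / K) ^ s` with `s` at choice. The factor 2 pays for rounding
  -- `N` up to a multiple of `B`.
  null-avoids : ∀ {χ} t → c < K → (∀ s → χ ⊑ avoids t s) → Null χ
  null-avoids {χ} t c<K sub M =
    let d = cnt ≢c K
        s , gap = ^-gap (cnt-≢c c<K) (2 * M)
        B = K ^ (t + s)
    in B , λ N B≤N →
      let instance
            B≢0 : NonZero B
            B≢0 = m^n≢0 K (t + s)
          q , Bq≤N , N<Bq+ = divide B N
          1≤q : 1 ≤ q
          1≤q = s≤s⁻¹ (*-cancelˡ-< B 1 (suc q) (≤-<-trans (≤-trans (≤-reflexive (*-identityʳ B)) B≤N) N<Bq+))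
      in *-cancelˡ-≤ 2 (begin
        2 * (M * cnt χ N)                      ≤⟨ *-monoʳ-≤ 2 (*-monoʳ-≤ M (≤-trans (cnt-mono (sub s) N) (cnt-monoʳ (avoids t s) (<⇒≤ N<Bq+)))) ⟩
        2 * (M * cnt (avoids t s) (B * suc q)) ≤⟨ *-monoʳ-≤ 2 (*-monoʳ-≤ M (cnt-avoids t s (suc q))) ⟩
        2 * (M * (d ^ s * K ^ t * suc q))      ≡⟨ eq M (d ^ s) (K ^ t) (suc q) ⟩
        2 * M * d ^ s * (K ^ t * suc q)        ≤⟨ *-monoˡ-≤ (K ^ t * suc q) gap ⟩
        K ^ s * (K ^ t * suc q)                ≡⟨ eq′ (K ^ s) (K ^ t) (suc q) ⟩
        K ^ t * K ^ s * suc q                  ≡⟨ cong (_* suc q) (sym (^-distribˡ-+-* K t s)) ⟩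
        B * suc q                              ≤⟨ *-monoʳ-≤ B (+-monoˡ-≤ q 1≤q) ⟩
        B * (q + q)                            ≡⟨ eq″ B q ⟩
        2 * (B * q)                            ≤⟨ *-monoʳ-≤ 2 Bq≤N ⟩
        2 * N                                  ∎)
    where
    open ≤-Reasoning
    eq : ∀ M d k q → 2 * (M * (d * k * q)) ≡ 2 * M * d * (k * q)
    eq = solve-∀
    eq′ : ∀ a b q → a * (b * q) ≡ b * a * q
    eq′ = solve-∀
    eq″ : ∀ B q → B * (q + q) ≡ 2 * (B * q)
    eq″ = solve-∀

  cone-/ : ∀ {n J y} → Cone K n J (y / K) → Cone K n (suc J) y
  cone-/ {n} {J} {y} (lo , hi) =
    (begin
      n * (K * K ^ J)    ≡⟨ eq n K (K ^ J) ⟩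
      n * K ^ J * K      ≤⟨ *-monoˡ-≤ K lo ⟩
      y / K * K          ≤⟨ m≤n+m _ (y % K) ⟩
      y % K + y / K * K  ≡⟨ m≡m%n+[m/n]*n y K ⟨
      y                  ∎) ,
    (begin-strict
      y                  ≡⟨ m≡m%n+[m/n]*n y K ⟩
      y % K + y / K * K  <⟨ +-monoˡ-< (y / K * K) (m%n<n y K) ⟩
      suc (y / K) * K    ≤⟨ *-monoˡ-≤ K hi ⟩
      suc n * K ^ J * K  ≡⟨ sym (eq (suc n) K (K ^ J)) ⟩
      suc n * (K * K ^ J) ∎)
    where
    open ≤-Reasoning
    eq : ∀ n K x → n * (K * x) ≡ n * x * K
    eq = solve-∀

  opaque
    -- The prefix of `y` that ends in the digit found at position `J` is the head of the cone.
    has-digit : ∀ t s y → avoids t s y ≡ false →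
      ∃[ J ] ∃[ a ] t ≤ J × Cone K (K * a + c) J y
    has-digit zero (suc s) y eq with y % K ≟ c
    ... | yes y%K≡c = 0 , y / K , z≤n ,
      ≤-reflexive (trans (*-identityʳ _) (sym y≡)) ,
      ≤-reflexive (trans (cong suc y≡) (sym (*-identityʳ _)))
      where
      y≡ : y ≡ K * (y / K) + c
      y≡ = trans (m≡m%n+[m/n]*n y K) (trans (+-comm (y % K) _) (cong₂ _+_ (*-comm (y / K) K) y%K≡c))
    ... | no y%K≢c = let J , a , _ , cone = has-digit zero s (y / K) (trans (cong (λ b → not b ∧ avoids 0 s (y / K)) (sym (dec-false (y % K ≟ c) y%K≢c))) eq) in
      suc J , a , z≤n , cone-/ {K * a + c} {J} cone
    has-digit (suc t) s y eq =
      let J , a , t≤J , cone = has-digit t s (y / K) eq in suc J , a , s≤s t≤J , cone-/ {K * a + c} {J} cone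

-- Eventual periodicity in finite sets

∣! : ∀ {i n} → 1 ≤ i → i ≤ n → i ∣ n !
∣! {i} {zero} 1≤i i≤0 = contradiction (≤-trans 1≤i i≤0) λ ()
∣! {i} {suc n} 1≤i i≤1+n = case m≤n⇒m<n∨m≡n i≤1+n of λ where
  (inj₁ i<1+n) → ∣-trans (∣! 1≤i (s≤s⁻¹ i<1+n)) (n∣m*n (suc n))
  (inj₂ refl) → m∣m*n (n !)

n≤n! : ∀ n → n ≤ n !
n≤n! zero = z≤n
n≤n! (suc n) = m≤m*n (suc n) (n !) {{n !≢0}}

-- By the pigeonhole principle some `d ≤ n` is a period from an index below `n` on. Every such `d`
-- divides `n !`, which therefore serves all sequences alike.
eventually-periodic : ∀ {n} (s : ℕ → Fin n) → (∀ i j → s i ≡ s j → s (suc i) ≡ s (suc j)) →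
  ∀ {x} → n ≤ x → ∀ q → s (x + q * n !) ≡ s x
eventually-periodic {n} s step {x} n≤x q =
  let i , j , i<j , j≤n , eq = pigeonhole-ℕ s
      d = j ∸ i
      i+d≡j = m+[n∸m]≡n (<⇒≤ i<j)
      i≤x = ≤-trans (<⇒≤ i<j) (≤-trans j≤n n≤x)
      shift : ∀ y → s (y + i + d) ≡ s (y + i)
      shift y = trans (cong s (trans (+-assoc y i d) (cong (y +_) i+d≡j))) (go y (sym eq))
      shifts : ∀ r y → s (y + i + r * d) ≡ s (y + i)
      shifts r = multiple r i d shift
  in case ∣! {d} {n} (m<n⇒0<n∸m i<j) (≤-trans (m∸n≤m j i) j≤n) of λ where
    (divides r n!≡) → subst (λ z → s (z + q * n !) ≡ s z) (m∸n+n≡m i≤x)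
      (trans (cong (λ t → s (x ∸ i + i + t)) (trans (cong (q *_) n!≡) (sym (*-assoc q r d))))
        (shifts (q * r) (x ∸ i)))
  where
  go : ∀ {i j} y → s i ≡ s j → s (y + i) ≡ s (y + j)
  go zero eq = eq
  go {i} {j} (suc y) eq = step (y + i) (y + j) (go y eq)
  multiple : ∀ r i d → (∀ y → s (y + i + d) ≡ s (y + i)) → ∀ y → s (y + i + r * d) ≡ s (y + i)
  multiple zero i d h y = cong s (+-identityʳ (y + i))
  multiple (suc r) i d h y = trans (cong s (eq y i d (r * d)))
    (trans (multiple r i d h (y + d)) (trans (cong s (eq′ y i d)) (h y)))
    where
    eq : ∀ y i d z → y + i + (d + z) ≡ y + d + i + z
    eq = solve-∀
    eq′ : ∀ y i d → y + d + i ≡ y + i + d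
    eq′ = solve-∀

powers-periodic : ∀ K P .{{_ : NonZero P}} {x} → P ≤ x → ∀ q →
  K ^ (x + q * P !) % P ≡ K ^ x % P
powers-periodic K P {x} P≤x q = trans (sym (toℕ-fromℕ< _)) (trans
    (cong toℕ (eventually-periodic residue (λ i j → step i j) P≤x q)) (toℕ-fromℕ< _))
  where
  residue : ℕ → Fin P
  residue i = fromℕ< (m%n<n (K ^ i) P)
  step : ∀ i j → residue i ≡ residue j → residue (suc i) ≡ residue (suc j)
  step i j eq = fromℕ<-cong _ _ (trans (%-distribˡ-* K (K ^ i) P) (trans
    (cong (λ t → K % P * t % P) (trans (sym (toℕ-fromℕ< _)) (trans (cong toℕ eq) (toℕ-fromℕ< _))))
    (sym (%-distribˡ-* K (K ^ j) P)))) _ _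

powers-independent : ∀ {x y} a b → 1 ≤ a → MultiplicativelyIndependent x y →
  MultiplicativelyIndependent (x ^ a) (y ^ b)
powers-independent {x} {y} a b 1≤a ind s t 1≤t eq =
  ind (b * s) (a * t) (*-mono-≤ 1≤a 1≤t)
    (trans (sym (^-*-assoc x a t)) (trans eq (^-*-assoc y b s)))

2≤^ : ∀ {a n} → 2 ≤ a → 1 ≤ n → 2 ≤ a ^ n
2≤^ {a} {n} 2≤a 1≤n = ≤-trans 2≤a (≤-trans (≤-reflexive (sym (^-identityʳ a)))
  (^-monoʳ-≤ a {{≥2⇒nonZero 2≤a}} 1≤n))

-- Multiply n₁ by L ^ d / K ^ e, slightly larger than 1, until the product
-- passes a multiple n₂ * K ^ C of n₂.
opaque
  powers-meet : ∀ {K L} → 2 ≤ K → 2 ≤ L → MultiplicativelyIndependent K L →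
    ∀ n₁ n₂ → 1 ≤ n₁ → 1 ≤ n₂ → ∀ t →
    ∃[ j ] ∃[ J₁ ] ∃[ J₂ ] t ≤ J₁ × t ≤ J₂ × n₂ * K ^ J₂ ≤ L ^ j * (n₁ * K ^ J₁) ×
      L ^ j * suc (n₁ * K ^ J₁) ≤ suc n₂ * K ^ J₂
  powers-meet {K} {L} 2≤K 2≤L ind n₁ n₂ 1≤n₁ 1≤n₂ t =
    let instance
          K≢0 = ≥2⇒nonZero 2≤K
          n₂≢0 = >-nonZero 1≤n₂
        -- A factor of at most `1 + 1 / n₂` cannot jump from below `n₂ * K ^ C` past
        -- `suc n₂ * K ^ C`.
        e , d , h<g , close = close-above 2≤K 2≤L ind n₂ 1≤n₂
        h = K ^ e
        g = L ^ d
        -- Makes `n₁` smaller than `n₂ * K ^ C`, so that the multiplication starts below its target.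
        C = suc n₁
        T = n₂ * K ^ C
        big , gap = ^-gap h<g T
        start : n₁ * g ^ 0 < T * h ^ 0
        start = subst₂ _<_ (sym (*-identityʳ n₁)) (sym (*-identityʳ T))
          (<-≤-trans (n<1+n n₁) (≤-trans (<⇒≤ (n<^n 2≤K C)) (m≤n*m (K ^ C) n₂)))
        s , _ , lt , nlt = crossing (λ s → n₁ * g ^ s <? T * h ^ s) big start
          (≤⇒≯ (≤-trans gap (m≤n*m (g ^ big) n₁ {{>-nonZero 1≤n₁}})))
        j = d * suc s
        S = C + e * suc s
        g^≡ : g ^ suc s ≡ L ^ j
        g^≡ = ^-*-assoc L d (suc s)
        h^≡ : K ^ C * h ^ suc s ≡ K ^ S
        h^≡ = trans (cong (K ^ C *_) (^-*-assoc K e (suc s))) (sym (^-distribˡ-+-* K C (e * suc s)))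
        lower : n₂ * K ^ S ≤ L ^ j * n₁
        lower = begin
          n₂ * K ^ S                ≡⟨ cong (n₂ *_) (sym h^≡) ⟩
          n₂ * (K ^ C * h ^ suc s)  ≡⟨ sym (*-assoc n₂ (K ^ C) _) ⟩
          T * h ^ suc s             ≤⟨ ≮⇒≥ nlt ⟩
          n₁ * g ^ suc s            ≡⟨ trans (cong (n₁ *_) g^≡) (*-comm n₁ (L ^ j)) ⟩
          L ^ j * n₁                ∎
        upper : L ^ j * n₁ < suc n₂ * K ^ S
        upper = *-cancelˡ-< n₂ _ _ (begin-strict
          n₂ * (L ^ j * n₁)         ≡⟨ cong (λ x → n₂ * (x * n₁)) (sym g^≡) ⟩
          n₂ * (g * g ^ s * n₁)     ≡⟨ eq₁ n₂ g (g ^ s) n₁ ⟩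
          n₂ * g * (n₁ * g ^ s)     <⟨ *-monoʳ-< (n₂ * g) {{m*n≢0 n₂ g {{n₂≢0}} {{m^n≢0 L d {{≥2⇒nonZero 2≤L}}}}}} lt ⟩
          n₂ * g * (T * h ^ s)      ≤⟨ *-monoˡ-≤ (T * h ^ s) close ⟩
          suc n₂ * h * (T * h ^ s)  ≡⟨ eq₂ n₂ h (K ^ C) (h ^ s) ⟩
          n₂ * (suc n₂ * (K ^ C * (h * h ^ s))) ≡⟨ cong (λ x → n₂ * (suc n₂ * x)) h^≡ ⟩
          n₂ * (suc n₂ * K ^ S)     ∎)
        -- Gives `L ^ j ≤ K ^ J₁`: the additional `L ^ j` in the upper estimate is then paid for by
        -- the strictness of `upper`.
        J₁ = L ^ j + t
        J₂ = S + J₁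
        K^J₂ : K ^ J₂ ≡ K ^ S * K ^ J₁
        K^J₂ = ^-distribˡ-+-* K S J₁
        L^j≤ : L ^ j ≤ K ^ J₁
        L^j≤ = ≤-trans (<⇒≤ (n<^n 2≤K (L ^ j))) (^-monoʳ-≤ K (m≤m+n (L ^ j) t))
    in j , J₁ , J₂ , m≤n+m t (L ^ j) , ≤-trans (m≤n+m t (L ^ j)) (m≤n+m J₁ S) ,
       (begin
         n₂ * K ^ J₂             ≡⟨ trans (cong (n₂ *_) K^J₂) (sym (*-assoc n₂ (K ^ S) (K ^ J₁))) ⟩
         n₂ * K ^ S * K ^ J₁     ≤⟨ *-monoˡ-≤ (K ^ J₁) lower ⟩
         L ^ j * n₁ * K ^ J₁     ≡⟨ *-assoc (L ^ j) n₁ (K ^ J₁) ⟩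
         L ^ j * (n₁ * K ^ J₁)   ∎) ,
       (begin
         L ^ j * suc (n₁ * K ^ J₁)       ≡⟨ eq₃ (L ^ j) n₁ (K ^ J₁) ⟩
         L ^ j + L ^ j * n₁ * K ^ J₁     ≤⟨ +-monoˡ-≤ (L ^ j * n₁ * K ^ J₁) L^j≤ ⟩
         suc (L ^ j * n₁) * K ^ J₁       ≤⟨ *-monoˡ-≤ (K ^ J₁) upper ⟩
         suc n₂ * K ^ S * K ^ J₁         ≡⟨ trans (*-assoc (suc n₂) (K ^ S) (K ^ J₁)) (cong (suc n₂ *_) (sym K^J₂)) ⟩
         suc n₂ * K ^ J₂                 ∎)
    where
    open ≤-Reasoning
    eq₁ : ∀ n g x y → n * (g * x * y) ≡ n * g * (y * x)
    eq₁ = solve-∀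
    eq₂ : ∀ n h k x → suc n * h * (n * k * x) ≡ n * (suc n * (k * (h * x)))
    eq₂ = solve-∀
    eq₃ : ∀ l n k → l * suc (n * k) ≡ l + l * n * k
    eq₃ = solve-∀

-- A common period on cones

-- f on the blocks m * K ^ b , … , (m + 2) * K ^ b - 1 is determined by W m.  The
-- blocks of m and m + 1 overlap, so that agreement carries over their border.
Lifts : ∀ {ω} {Ω : Set ω} → (ℕ → Ω) → ∀ {Q} → (ℕ → Fin Q) → ℕ → Set ω
Lifts f W K = ∀ b {m m′} → W m ≡ W m′ → ∀ {r} → r < 2 * K ^ b →
  f (K ^ b * m + r) ≡ f (K ^ b * m′ + r)

-- The exceptional set consists of block numbers and serves all `r` for a given `α`.
AlmostLifts : ∀ {ω} {Ω : Set ω} → (ℕ → Ω) → ∀ {Q} → (ℕ → Fin Q) → ℕ → Set ω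
AlmostLifts f W l = ∀ α → ∃[ χ ] Null χ ×
  (∀ {m m′} → χ m ≡ false → χ m′ ≡ false → W m ≡ W m′ →
    ∀ {r} → r < 2 * l ^ α → f (l ^ α * m + r) ≡ f (l ^ α * m′ + r))

-- Only the null set may depend on `j`, because `j` is chosen after `b` when powers of `l ^ b` and
-- `K` are matched.
AlmostDilates : ∀ {ω} {Ω : Set ω} → (ℕ → Ω) → ℕ → Set ω
AlmostDilates f l = ∀ ρ → ∃[ α ] ∃[ b ] 1 ≤ b × (∀ j → ∃[ χ ] Null χ ×
  (∀ {x} → χ x ≡ false → f ((l ^ b) ^ j * (l ^ α * x) + ρ) ≡ f (l ^ α * x + ρ)))

module CommonPeriod {ω} {Ω : Set ω} (f : ℕ → Ω) {Q} (W : ℕ → Fin Q)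
  {K l : ℕ} (2≤K : 2 ≤ K) (2≤l : 2 ≤ l) (ind : MultiplicativelyIndependent l K)
  (lift-K : Lifts f W K) (lift-l : AlmostLifts f W l)
  (c T₀ : ℕ)
  (connect : ∀ a {β β′ m m′} → Cone K (K * a + c) β m → Cone K (K * a + c) β′ m′ →
    ∃[ y ] y < K ^ T₀ × W (K ^ T₀ * m + y) ≡ W m′)
  where

  private instance
    K≢0 : NonZero K
    K≢0 = ≥2⇒nonZero 2≤K
    l≢0 : NonZero l
    l≢0 = ≥2⇒nonZero 2≤l

  -- The number of pairs of states, hence a bound for the offsets that the pigeonhole principle
  -- yields.
  D : ℕ
  D = Q * Q

  -- a₁ = K ^ β lies so little above b₁ = l ^ α that Δ = a₁ - b₁ is small even
  -- compared with K ^ b.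
  opaque
    scales : ∃[ α ] ∃[ b ] ∃[ Δ ] 1 ≤ Δ × K ^ (suc T₀ + b) ≡ l ^ α + Δ ×
      (D ! + (D + 2)) * Δ ≤ K ^ b
    scales =
      -- The power of `K` reserves `T₀` digits for `connect` and one for `a₁ = K * u`; `D !` bounds
      -- the period `P`, and `D + 2` the drift between the two scales.
      let N = K ^ suc T₀ * (D ! + (D + 2))
          1≤N : 1 ≤ N
          1≤N = *-mono-≤ (m^n>0 K (suc T₀)) (≤-trans (1≤n! D) (m≤m+n (D !) _))
          α , β , lt , close = close-above 2≤l 2≤K ind N 1≤N
          Δ = K ^ β ∸ l ^ α
          Kβ≡ : l ^ α + Δ ≡ K ^ β
          Kβ≡ = m+[n∸m]≡n (<⇒≤ lt)
          1≤Δ : 1 ≤ Δ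
          1≤Δ = m<n⇒0<n∸m lt
          NΔ≤ : N * Δ ≤ l ^ α
          NΔ≤ = linear 0 close (trans (eq₁ N Δ (l ^ α)) (cong (λ t → l ^ α + N * t) Kβ≡))
          NΔ<Kβ : N * Δ < K ^ β
          NΔ<Kβ = ≤-<-trans NΔ≤ lt
          T<β : suc T₀ < β
          T<β = ^-cancel-< K (<⇒≤ 2≤K) (≤-<-trans (≤-trans (m≤m*n (K ^ suc T₀) (D ! + (D + 2)) {{>-nonZero (≤-trans (1≤n! D) (m≤m+n (D !) _))}})
             (m≤m*n N Δ {{>-nonZero 1≤Δ}})) NΔ<Kβ)
          b = β ∸ suc T₀
          β≡ : suc T₀ + b ≡ β
          β≡ = m+[n∸m]≡n (<⇒≤ T<β)
          split : K ^ β ≡ K ^ suc T₀ * K ^ b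
          split = trans (cong (K ^_) (sym β≡)) (^-distribˡ-+-* K (suc T₀) b)
      in α , b , Δ , 1≤Δ , trans (cong (K ^_) β≡) (sym Kβ≡) ,
         *-cancelˡ-≤ (K ^ suc T₀) {{m^n≢0 K (suc T₀)}} (≤-trans
           (≤-reflexive (sym (*-assoc (K ^ suc T₀) _ Δ)))
           (≤-trans (<⇒≤ NΔ<Kβ) (≤-reflexive split)))
      where
      eq₁ : ∀ N Δ x → N * Δ + suc N * x + 0 ≡ x + N * (x + Δ)
      eq₁ = solve-∀

  α = proj₁ scales
  b = proj₁ (proj₂ scales)
  Δ = proj₁ (proj₂ (proj₂ scales))
  1≤Δ = proj₁ (proj₂ (proj₂ (proj₂ scales)))
  a₁≡ = proj₁ (proj₂ (proj₂ (proj₂ (proj₂ scales))))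
  small = proj₂ (proj₂ (proj₂ (proj₂ (proj₂ scales))))

  -- A period is found on blocks of length `u` and carried over on blocks of length `u′`. `P` is a
  -- multiple of `(j - i) * Δ` for all `0 < j - i ≤ D`.
  a₁ b₁ u u′ P : ℕ
  a₁ = K ^ (suc T₀ + b)
  b₁ = l ^ α
  u = K ^ T₀ * K ^ b
  u′ = K ^ b
  P = D ! * Δ

  1≤P : 1 ≤ P
  1≤P = *-mono-≤ (1≤n! D) 1≤Δ

  P≤u′ : P ≤ u′
  P≤u′ = ≤-trans (*-monoˡ-≤ Δ (m≤m+n (D !) _)) small

  a₁≡Ku : a₁ ≡ K * u
  a₁≡Ku = cong (K *_) (^-distribˡ-+-* K T₀ b)

  u′≤u : u′ ≤ u
  u′≤u = m≤n*m u′ (K ^ T₀) {{m^n≢0 K T₀}}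

  [D+2]Δ≤u : (D + 2) * Δ ≤ u
  [D+2]Δ≤u = ≤-trans (*-monoˡ-≤ Δ (m≤n+m (D + 2) (D !))) (≤-trans small u′≤u)

  2u≤a₁ : 2 * u ≤ a₁
  2u≤a₁ = ≤-trans (*-monoˡ-≤ u 2≤K) (≤-reflexive (sym a₁≡Ku))

  D<b₁ : D < b₁
  D<b₁ = +-cancelʳ-≤ Δ (suc D) b₁ (begin
    suc D + Δ            ≤⟨ linear 0 (*-monoʳ-≤ (D + 1) 1≤Δ) (eq D Δ) ⟩
    (D + 2) * Δ          ≤⟨ [D+2]Δ≤u ⟩
    u                    ≤⟨ m≤m+n u (u + 0) ⟩
    2 * u                ≤⟨ 2u≤a₁ ⟩
    a₁                   ≡⟨ a₁≡ ⟩
    b₁ + Δ               ∎)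
    where
    open ≤-Reasoning
    eq : ∀ D Δ → suc D + Δ + (D + 1) * Δ + 0 ≡ (D + 2) * Δ + (D + 1) * 1
    eq = solve-∀

  b₁<a₁ : b₁ < a₁
  b₁<a₁ = ≤-trans (≤-trans (≤-reflexive (+-comm 1 b₁)) (+-monoʳ-≤ b₁ 1≤Δ)) (≤-reflexive (sym a₁≡))

  iterate-period : ∀ p lo hi → (∀ z → lo ≤ z → z + p < hi → f (z + p) ≡ f z) →
    ∀ q z → lo ≤ z → z + q * p < hi → f (z + q * p) ≡ f z
  iterate-period p lo hi per zero z _ _ = cong f (+-identityʳ z)
  iterate-period p lo hi per (suc q) z lo≤z <hi =
    trans (cong f (eq z p (q * p))) (trans
      (per (z + q * p) (≤-trans lo≤z (m≤m+n z (q * p))) (≤-<-trans (≤-reflexive (sym (eq z p (q * p)))) <hi))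
      (iterate-period p lo hi per q z lo≤z (≤-<-trans (+-monoʳ-≤ z (m≤n+m (q * p) p)) <hi)))
    where
    eq : ∀ z p t → z + (p + t) ≡ z + t + p
    eq = solve-∀

  -- W takes the same value at n + i, n + j and at m + i, m + j, where
  -- a₁ n = b₁ m.  Going from a₁ (n + j) + r down to the block of n + i and up
  -- again from the block of m + i to that of m + j is a shift by (j - i) Δ.
  opaque
    block-period : ∀ n₀ → ∃[ n₁ ] ∃[ J ] Cone K n₀ J n₁ ×
      (∀ z → n₁ * u ≤ z → z + P < (n₁ + 2) * u → f (z + P) ≡ f z)
    block-period n₀ =
      let χ , null , lift = lift-l α
          -- One `a` serves both scales: `b₁ * a` lies in the cone of `n₀`, while the window at
          -- `a₁ * a` avoids the null set.
          a , J , lo , hi , free = free-multiple-in-cone {K} {b₁} {a₁} {χ} n₀ 2≤K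
            (m^n>0 l α) (m^n>0 K (suc T₀ + b)) null
          n = b₁ * a
          m = a₁ * a
          i , j , i<j , j≤D , eq = pigeonhole-ℕ (λ i → combine (W (n + i)) (W (m + i)))
          Wn , Wm = combine-injective (W (n + i)) (W (m + i)) (W (n + j)) (W (m + j)) eq
          e = j ∸ i
          i+e≡j = m+[n∸m]≡n (<⇒≤ i<j)
          j<b₁ = ≤-<-trans j≤D D<b₁
          j<a₁ = <-trans j<b₁ b₁<a₁
          -- Since `a₁ = K * u`, the block `n + j` of length `a₁` starts with the block `n₁` of
          -- length `u`.
          n₁ = K * (n + j)
          n₁u : n₁ * u ≡ a₁ * (n + j)
          n₁u = trans (eq₀ K (n + j) u) (cong (_* (n + j)) (sym a₁≡Ku))
          shiftA : ∀ {r} → r < 2 * a₁ → f (a₁ * (n + i) + r) ≡ f (a₁ * (n + j) + r)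
          shiftA = lift-K (suc T₀ + b) Wn
          shiftB : ∀ {r} → r < 2 * b₁ → f (b₁ * (m + i) + r) ≡ f (b₁ * (m + j) + r)
          shiftB = lift (free i (<-trans i<j j<a₁)) (free j j<a₁) Wm
          step : ∀ z → n₁ * u ≤ z → z + e * Δ < (n₁ + 2) * u → f (z + e * Δ) ≡ f z
          step z n₁u≤z z< =
            let r = z ∸ n₁ * u
                z≡′ : n₁ * u + r ≡ z
                z≡′ = m+[n∸m]≡n n₁u≤z
                z≡ : a₁ * (n + j) + r ≡ z
                z≡ = trans (cong (_+ r) (sym n₁u)) z≡′
                r+p<2u : r + e * Δ < 2 * u
                r+p<2u = +-cancelˡ-< (n₁ * u) _ _ (subst₂ _<_
                  (trans (cong (_+ e * Δ) (sym z≡′)) (+-assoc (n₁ * u) r (e * Δ)))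
                  (*-distribʳ-+ u n₁ 2) z<)
                -- On the `l` side the offset has drifted by `Δ * j`; the bound on `(D + 2) * Δ`
                -- keeps it within two blocks.
                Δj+r<2b₁ : Δ * j + r < 2 * b₁
                Δj+r<2b₁ = +-cancelʳ-< (2 * Δ) _ _ (begin-strict
                  Δ * j + r + 2 * Δ        ≤⟨ +-monoˡ-≤ (2 * Δ) (+-monoˡ-≤ r (*-monoʳ-≤ Δ j≤D)) ⟩
                  Δ * D + r + 2 * Δ        ≡⟨ eq₁ Δ D r ⟩
                  (D + 2) * Δ + r          <⟨ +-mono-≤-< (≤-trans [D+2]Δ≤u (m≤m+n u (u + 0)))
                                                (≤-<-trans (m≤m+n r (e * Δ)) r+p<2u) ⟩
                  2 * u + 2 * u            ≤⟨ +-mono-≤ 2u≤a₁ 2u≤a₁ ⟩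
                  a₁ + a₁                  ≡⟨ cong₂ _+_ a₁≡ a₁≡ ⟩
                  (b₁ + Δ) + (b₁ + Δ)      ≡⟨ eq₂ b₁ Δ ⟩
                  2 * b₁ + 2 * Δ           ∎)
            in (trans (cong f (trans (cong (_+ e * Δ) (sym z≡)) (+-assoc (a₁ * (n + j)) r (e * Δ))))
              (trans (sym (shiftA (<-≤-trans r+p<2u (≤-trans 2u≤a₁ (m≤m+n a₁ (a₁ + 0))))))
              (trans (cong f (down a i e j r i+e≡j))
              (trans (shiftB Δj+r<2b₁)
              (cong f (trans (up a j r) z≡))))))
          q , D!≡ = case ∣! {e} {D} (m<n⇒0<n∸m i<j) (≤-trans (m∸n≤m j i) j≤D) of λ where
            (divides q D!≡) → q , D!≡
          P≡ : q * (e * Δ) ≡ P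
          P≡ = trans (sym (*-assoc q e Δ)) (cong (_* Δ) (sym D!≡))
      in n₁ , suc J ,
         ((begin
           n₀ * (K * K ^ J)     ≡⟨ eq₃ n₀ K (K ^ J) ⟩
           K * (n₀ * K ^ J)     ≤⟨ *-monoʳ-≤ K (≤-trans lo (m≤m+n n j)) ⟩
           n₁                   ∎) ,
          (begin-strict
           K * (n + j)          <⟨ *-monoʳ-< K (+-monoʳ-< n j<b₁) ⟩
           K * (b₁ * a + b₁)    ≡⟨ cong (K *_) (trans (+-comm (b₁ * a) b₁) (sym (*-suc b₁ a))) ⟩
           K * (b₁ * suc a)     ≤⟨ *-monoʳ-≤ K hi ⟩
           K * (suc n₀ * K ^ J) ≡⟨ sym (eq₃ (suc n₀) K (K ^ J)) ⟩
           suc n₀ * (K * K ^ J) ∎)) ,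
         λ z lo z< → subst (λ P → f (z + P) ≡ f z) P≡
           (iterate-period (e * Δ) (n₁ * u) ((n₁ + 2) * u) step q z lo
             (subst (λ P → z + P < (n₁ + 2) * u) (sym P≡) z<))
      where
      open ≤-Reasoning
      eq₀ : ∀ K n u → K * n * u ≡ K * u * n
      eq₀ = solve-∀
      eq₁ : ∀ Δ D r → Δ * D + r + 2 * Δ ≡ (D + 2) * Δ + r
      eq₁ = solve-∀
      eq₂ : ∀ b Δ → (b + Δ) + (b + Δ) ≡ 2 * b + 2 * Δ
      eq₂ = solve-∀
      eq₃ : ∀ n K x → n * (K * x) ≡ K * (n * x)
      eq₃ = solve-∀
      down : ∀ a i e j r → i + e ≡ j →
        a₁ * (b₁ * a + i) + (r + e * Δ) ≡ b₁ * (a₁ * a + i) + (Δ * j + r)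
      down a i e j r i+e≡j = subst₂ (λ A j → A * (b₁ * a + i) + (r + e * Δ) ≡ b₁ * (A * a + i) + (Δ * j + r))
        (sym a₁≡) i+e≡j (eq b₁ Δ a i e r)
        where
        eq : ∀ b Δ a i e r → (b + Δ) * (b * a + i) + (r + e * Δ) ≡ b * ((b + Δ) * a + i) + (Δ * (i + e) + r)
        eq = solve-∀
      up : ∀ a j r → b₁ * (a₁ * a + j) + (Δ * j + r) ≡ a₁ * (b₁ * a + j) + r
      up a j r = subst (λ A → b₁ * (A * a + j) + (Δ * j + r) ≡ A * (b₁ * a + j) + r) (sym a₁≡) (eq b₁ Δ a j r)
        where
        eq : ∀ b Δ a j r → b * ((b + Δ) * a + j) + (Δ * j + r) ≡ (b + Δ) * (b * a + j) + r
        eq = solve-∀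

    -- `connect` finds, inside block `n₁` of length `u`, a block of length `u′` with the same state
    -- as the one containing `z`. A step by `P` may enter the next block, whence the two blocks in
    -- `Lifts` and the `n₁ + 2` in `block-period`.
    cone-period : ∀ a J z → b ≤ J → Cone K (K * a + c) J z → f (z + P) ≡ f z
    cone-period a J z b≤J (lo , hi) =
      let instance
            u′≢0 : NonZero u′
            u′≢0 = m^n≢0 K b
          n₀ = K * a + c
          n₁ , J₁ , cone₁ , period = block-period n₀
          J′ = J ∸ b
          split : K ^ J ≡ u′ * K ^ J′
          split = trans (cong (K ^_) (sym (m+[n∸m]≡n b≤J))) (^-distribˡ-+-* K b J′)
          m , u′m≤z , z<u′m+ = divide u′ z
          r = z ∸ u′ * m
          z≡ : u′ * m + r ≡ z
          z≡ = m+[n∸m]≡n u′m≤z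
          r<u′ : r < u′
          r<u′ = +-cancelˡ-< (u′ * m) r u′ (subst₂ _<_ (sym z≡) (trans (*-suc u′ m) (+-comm u′ (u′ * m))) z<u′m+)
          coneₘ : Cone K n₀ J′ m
          coneₘ = s≤s⁻¹ (*-cancelˡ-< u′ _ _ (≤-<-trans (≤-trans (≤-reflexive (scale n₀ J′ split)) lo) z<u′m+)) ,
                  *-cancelˡ-< u′ _ _ (≤-<-trans u′m≤z (<-≤-trans hi (≤-reflexive (sym (scale (suc n₀) J′ split)))))
          y , y<T , Wy = connect a {J₁} {J′} cone₁ coneₘ
          Z = u′ * (K ^ T₀ * n₁ + y)
          r+P<2u′ : r + P < 2 * u′
          r+P<2u′ = <-≤-trans (+-mono-<-≤ r<u′ P≤u′) (≤-reflexive (cong (u′ +_) (sym (+-identityʳ u′))))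
      in (trans (cong f (trans (cong (_+ P) (sym z≡)) (+-assoc (u′ * m) r P)))
         (trans (lift-K b (sym Wy) r+P<2u′)
         (trans (cong f (sym (+-assoc Z r P)))
         (trans (period (Z + r)
           (begin
             n₁ * u                       ≡⟨ eq₁ n₁ (K ^ T₀) u′ ⟩
             u′ * (K ^ T₀ * n₁)           ≤⟨ *-monoʳ-≤ u′ (m≤m+n (K ^ T₀ * n₁) y) ⟩
             Z                            ≤⟨ m≤m+n Z r ⟩
             Z + r                        ∎)
           (begin-strict
             Z + r + P                    ≡⟨ +-assoc Z r P ⟩
             Z + (r + P)                  <⟨ +-monoʳ-< Z r+P<2u′ ⟩
             Z + 2 * u′                   ≡⟨ eq₂ u′ (K ^ T₀ * n₁) y ⟩
             u′ * (K ^ T₀ * n₁ + suc y) + u′  ≤⟨ +-mono-≤ (*-monoʳ-≤ u′ (+-monoʳ-≤ (K ^ T₀ * n₁) y<T)) u′≤u ⟩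
             u′ * (K ^ T₀ * n₁ + K ^ T₀) + u  ≡⟨ eq₃ u′ (K ^ T₀) n₁ ⟩
             (n₁ + 2) * u                 ∎))
         (trans (lift-K b Wy (≤-<-trans (m≤m+n r P) r+P<2u′))
         (cong f z≡))))))
      where
      open ≤-Reasoning
      scale : ∀ n J′ → K ^ J ≡ u′ * K ^ J′ → u′ * (n * K ^ J′) ≡ n * K ^ J
      scale n J′ split = trans (eq u′ n (K ^ J′)) (cong (n *_) (sym split))
        where
        eq : ∀ u n x → u * (n * x) ≡ n * (u * x)
        eq = solve-∀
      eq₁ : ∀ n t u → n * (t * u) ≡ u * (t * n)
      eq₁ = solve-∀
      eq₂ : ∀ u x y → u * (x + y) + 2 * u ≡ u * (x + suc y) + u
      eq₂ = solve-∀
      eq₃ : ∀ u t n → u * (t * n + t) + t * u ≡ (n + 2) * (t * u)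
      eq₃ = solve-∀

-- Comparison of cones

module _ (P : ℕ) .{{_ : NonZero P}} where

  %-cong-+ : ∀ {a a′ b b′} → a % P ≡ a′ % P → b % P ≡ b′ % P → (a + b) % P ≡ (a′ + b′) % P
  %-cong-+ {a} {a′} {b} {b′} p q = trans (%-distribˡ-+ a b P)
    (trans (cong₂ (λ x y → (x + y) % P) p q) (sym (%-distribˡ-+ a′ b′ P)))

  %-cong-* : ∀ x {a b} → a % P ≡ b % P → (x * a) % P ≡ (x * b) % P
  %-cong-* x {a} {b} p = trans (%-distribˡ-* x a P)
    (trans (cong (λ y → (x % P * y) % P) p) (sym (%-distribˡ-* x b P)))

  %-complement : ∀ b t → (b + t + pred P * b) % P ≡ t % P
  %-complement b t = trans (cong (_% P) (trans (eq b t (pred P)) (cong (λ p → t + b * p) (suc-pred P)))) ([m+kn]%n≡m%n t b P)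
    where
    eq : ∀ b t p → b + t + p * b ≡ t + b * suc p
    eq = solve-∀

  %-cancel-+ : ∀ {b b′ t t′} → b % P ≡ b′ % P → (b + t) % P ≡ (b′ + t′) % P → t % P ≡ t′ % P
  %-cancel-+ {b} {b′} {t} {t′} p q = trans (sym (%-complement b t))
    (trans (%-cong-+ q (%-cong-* (pred P) p)) (%-complement b′ t′))

module Gluing {ω} {Ω : Set ω} (f : ℕ → Ω) {Q} (W : ℕ → Fin Q)
  {K l : ℕ} (2≤K : 2 ≤ K) (2≤l : 2 ≤ l) (ind : MultiplicativelyIndependent K l)
  (lift-K : Lifts f W K) (zeros : ∀ n → W (K * (K * n)) ≡ W (K * n))
  (dilate : AlmostDilates f l)
  (c : ℕ) (1≤c : 1 ≤ c) (c<K : c < K)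
  (P B : ℕ) (1≤P : 1 ≤ P)
  (period : ∀ a J z → B ≤ J → Cone K (K * a + c) J z → f (z + P) ≡ f z)
  where

  private instance
    K≢0 : NonZero K
    K≢0 = ≥2⇒nonZero 2≤K
    P≢0 : NonZero P
    P≢0 = >-nonZero 1≤P

  -- In base E = K ^ φ all powers E , E² , … are congruent modulo P, so that
  -- moving a cone up does not change the residues of its points.
  φ E : ℕ
  φ = suc (B + P) * P !
  E = K ^ φ

  -- Positive powers of `E` are thereby past the height `B` from which the period holds, and past
  -- the preperiod of the powers of `K` modulo `P`.
  B+P<φ : suc (B + P) ≤ φ
  B+P<φ = m≤m*n (suc (B + P)) (P !) {{P !≢0}}

  1≤φ : 1 ≤ φ
  1≤φ = ≤-trans (s≤s z≤n) B+P<φ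

  2≤E : 2 ≤ E
  2≤E = 2≤^ 2≤K 1≤φ

  private instance
    E≢0 : NonZero E
    E≢0 = ≥2⇒nonZero 2≤E

  P≤E : P ≤ E
  P≤E = ≤-trans (m≤n+m P (suc B)) (≤-trans B+P<φ (<⇒≤ (n<^n 2≤K φ)))

  E^≡ : ∀ J → E ^ J ≡ K ^ (φ * J)
  E^≡ J = ^-*-assoc K φ J

  E^%P : ∀ J → E ^ suc J % P ≡ E % P
  E^%P J = trans (cong (_% P) (trans (E^≡ (suc J)) (cong (K ^_) (eq (suc (B + P)) (P !) J))))
    (powers-periodic K P (≤-trans (m≤n+m P (suc B)) B+P<φ) (suc (B + P) * J))
    where
    eq : ∀ x y J → x * y * suc J ≡ x * y + x * J * y
    eq = solve-∀

  head : ℕ → ℕ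
  head a = E * a + c

  cone-period : ∀ {a J z} → 1 ≤ J → Cone E (head a) J z → f (z + P) ≡ f z
  cone-period {a} {J} {z} 1≤J = period (K ^ pred φ * a) (φ * J) z
      (≤-trans (≤-trans (m≤m+n B P) (≤-trans (n≤1+n (B + P)) B+P<φ)) (m≤m*n φ J {{>-nonZero 1≤J}})) ∘
    subst₂ (λ n k → n * k ≤ z × z < suc n * k) head≡ (E^≡ J)
    where
    head≡ : head a ≡ K * (K ^ pred φ * a) + c
    head≡ = cong (_+ c) (trans (cong (λ φ → K ^ φ * a) (sym (suc-pred φ {{>-nonZero 1≤φ}}))) (*-assoc K (K ^ pred φ) a))

  cone-periods : ∀ {a J} → 1 ≤ J → ∀ q t → t + q * P < E ^ J →
    f (head a * E ^ J + (t + q * P)) ≡ f (head a * E ^ J + t)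
  cone-periods 1≤J zero t _ = cong (λ t → f (_ + t)) (+-identityʳ t)
  cone-periods {a} {J} 1≤J (suc q) t lt = trans (cong f (eq (head a * E ^ J) t P (q * P)))
    (trans (cone-period {a} {J} 1≤J
      (m≤m+n _ _ , <-≤-trans (+-monoʳ-< (head a * E ^ J) lt′) (≤-reflexive (+-comm _ (E ^ J)))))
      (cone-periods {a} {J} 1≤J q t lt′))
    where
    lt′ : t + q * P < E ^ J
    lt′ = ≤-<-trans (+-monoʳ-≤ t (m≤n+m (q * P) P)) lt
    eq : ∀ b t p x → b + (t + (p + x)) ≡ b + (t + x) + p
    eq = solve-∀

  zeros-^ : ∀ i n → W (K ^ suc i * n) ≡ W (K * n)
  zeros-^ zero n = cong W (cong (_* n) (*-identityʳ K))
  zeros-^ (suc i) n = trans (cong W (eq K (K ^ i) n)) (trans (zeros (K ^ i * n))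
    (trans (cong W (sym (*-assoc K (K ^ i) n))) (zeros-^ i n)))
    where
    eq : ∀ K x n → K * (K * x) * n ≡ K * (K * (x * n))
    eq = solve-∀

  zeros-E : ∀ J n → W (E ^ suc J * n) ≡ W (K * n)
  zeros-E J n = trans (cong (λ x → W (x * n)) (trans (E^≡ (suc J))
      (cong (K ^_) (sym (suc-pred (φ * suc J) {{>-nonZero (*-mono-≤ 1≤φ (s≤s {0} {J} z≤n))}})))))
    (zeros-^ (pred (φ * suc J)) n)

  -- One factor `E` serves as block length; the others append zeros, and zeros after the first do
  -- not change `W`. Hence `2 ≤ J`.
  base : ∀ a J t → t < P → 2 ≤ J → f (head a * E ^ J + t) ≡ f (head a * E ^ 2 + t)
  base a (suc (suc J)) t t<P 2≤J = trans (cong (λ x → f (x + t)) (eq (head a) E (E ^ J)))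
    (trans (lift-K φ (trans (zeros-E J (head a)) (sym (zeros-E 0 (head a))))
      (<-≤-trans t<P (≤-trans P≤E (m≤m+n E (E + 0)))))
      (cong (λ x → f (x + t)) (sym (eq (head a) E (E ^ 0)))))
    where
    eq : ∀ n E x → n * (E * (E * x)) ≡ E * (E * x * n)
    eq = solve-∀
  base a (suc zero) t t<P (s≤s ())

  -- The period reduces the offset modulo `P`, and `base` then reduces the height to 2.
  offset : ∀ {a J z} → Cone E (head a) J z → 2 ≤ J →
    ∃[ t ] z ≡ head a * E ^ J + t × f z ≡ f (head a * E ^ 2 + t % P)
  offset {a} {J} {z} (lo , hi) 2≤J = t , sym z≡ ,
    trans (cong f (trans (sym z≡) (cong (head a * E ^ J +_) t≡)))
      (trans (cone-periods {a} {J} (<⇒≤ 2≤J) (t / P) (t % P) (subst (_< E ^ J) t≡ t<))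
        (base a J (t % P) (m%n<n t P) 2≤J))
    where
    t = z ∸ head a * E ^ J
    z≡ : head a * E ^ J + t ≡ z
    z≡ = m+[n∸m]≡n lo
    t≡ = m≡m%n+[m/n]*n t P
    t< : t < E ^ J
    t< = +-cancelˡ-< (head a * E ^ J) t (E ^ J)
      (subst₂ _<_ (sym z≡) (+-comm (E ^ J) (head a * E ^ J)) hi)

  same-cone : ∀ {a J J′ z z′} → Cone E (head a) J z → Cone E (head a) J′ z′ → 2 ≤ J → 2 ≤ J′ →
    z % P ≡ z′ % P → f z ≡ f z′
  same-cone {a} {J@(suc J-1)} {J′@(suc J′-1)} cone cone′ 2≤J 2≤J′ eq =
    let t , z≡ , fz = offset {a} {J} cone 2≤J
        t′ , z′≡ , fz′ = offset {a} {J′} cone′ 2≤J′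
        bases : (head a * E ^ J) % P ≡ (head a * E ^ J′) % P
        bases = %-cong-* P (head a) (trans (E^%P J-1) (sym (E^%P J′-1)))
        t≡t′ : t % P ≡ t′ % P
        t≡t′ = %-cancel-+ P bases (trans (cong (_% P) (sym z≡)) (trans eq (cong (_% P) z′≡)))
    in trans fz (trans (cong (λ t → f (head a * E ^ 2 + t)) t≡t′) (sym fz′))

  1≤head : ∀ a → 1 ≤ head a
  1≤head a = ≤-trans 1≤c (m≤n+m c (E * a))

  -- Two cones are compared through a multiple x of P, with l ^ α * x in the first
  -- and (l ^ b) ^ j * (l ^ α * x) in the second, avoiding the null set
  -- on which dilation by (l ^ b) ^ j may fail.
  opaque
    all-cones : ∀ {a a′ J J′ z z′} → Cone E (head a) J z → Cone E (head a′) J′ z′ →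
      2 ≤ J → 2 ≤ J′ → z % P ≡ z′ % P → f z ≡ f z′
    all-cones {a} {a′} {J} {J′} {z} {z′} cone cone′ 2≤J 2≤J′ eq =
      let ρ = z % P
          α , b , 1≤b , dil = dilate ρ
          L = l ^ b
          j , J₁ , J₂ , 2≤J₁ , 2≤J₂ , lower , upper = powers-meet 2≤E (2≤^ 2≤l 1≤b)
            (powers-independent φ b 1≤φ ind) (head a) (head a′) (1≤head a) (1≤head a′) 2
          χ , null , same = dil j
          l^α≢0 = m^n>0 l {{≥2⇒nonZero 2≤l}} α
          X = l ^ α * P
          -- `powers-meet` bounds the image of `suc u` too, so dilation by `L ^ j` carries the whole
          -- cone of `u` into that of `head a′`.
          u = head a * E ^ J₁
          x , H , lo , hi , free = free-multiple-in-cone {E} {X} {P} {χ} u 2≤E (*-mono-≤ l^α≢0 1≤P) 1≤P null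
          ρ<X : ρ < X
          ρ<X = <-≤-trans (m%n<n z P) (m≤n*m P (l ^ α) {{>-nonZero l^α≢0}})
          Y = l ^ α * (P * x)
          Y≡ : Y ≡ X * x
          Y≡ = sym (*-assoc (l ^ α) P x)
          Y+ρ< : Y + ρ < X * suc x
          Y+ρ< = <-≤-trans (+-monoʳ-< Y ρ<X) (≤-reflexive (trans (cong (_+ X) Y≡) (trans (+-comm (X * x) X) (sym (*-suc X x)))))
          raise : ∀ n J → n * E ^ J * E ^ H ≡ n * E ^ (J + H)
          raise n J = trans (*-assoc n (E ^ J) (E ^ H)) (cong (n *_) (sym (^-distribˡ-+-* E J H)))
          cone₁ : Cone E (head a) (J₁ + H) (Y + ρ)
          cone₁ =
            (begin
              head a * E ^ (J₁ + H)     ≡⟨ sym (raise (head a) J₁) ⟩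
              u * E ^ H                 ≤⟨ lo ⟩
              X * x                     ≡⟨ sym Y≡ ⟩
              Y                         ≤⟨ m≤m+n Y ρ ⟩
              Y + ρ                     ∎) ,
            (begin-strict
              Y + ρ                     <⟨ Y+ρ< ⟩
              X * suc x                 ≤⟨ hi ⟩
              suc u * E ^ H             ≤⟨ *-monoˡ-≤ (E ^ H) (+-monoˡ-≤ u (m^n>0 E J₁)) ⟩
              suc (head a) * E ^ J₁ * E ^ H  ≡⟨ raise (suc (head a)) J₁ ⟩
              suc (head a) * E ^ (J₁ + H) ∎)
          cone₂ : Cone E (head a′) (J₂ + H) (L ^ j * Y + ρ)
          cone₂ =
            (begin
              head a′ * E ^ (J₂ + H)    ≡⟨ sym (raise (head a′) J₂) ⟩
              head a′ * E ^ J₂ * E ^ H  ≤⟨ *-monoˡ-≤ (E ^ H) lower ⟩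
              L ^ j * u * E ^ H         ≡⟨ *-assoc (L ^ j) u (E ^ H) ⟩
              L ^ j * (u * E ^ H)       ≤⟨ *-monoʳ-≤ (L ^ j) lo ⟩
              L ^ j * (X * x)           ≡⟨ cong (L ^ j *_) (sym Y≡) ⟩
              L ^ j * Y                 ≤⟨ m≤m+n (L ^ j * Y) ρ ⟩
              L ^ j * Y + ρ             ∎) ,
            (begin-strict
              L ^ j * Y + ρ             ≤⟨ +-monoʳ-≤ (L ^ j * Y) (m≤n*m ρ (L ^ j) {{m^n≢0 L j {{m^n≢0 l b {{≥2⇒nonZero 2≤l}}}}}}) ⟩
              L ^ j * Y + L ^ j * ρ     ≡⟨ sym (*-distribˡ-+ (L ^ j) Y ρ) ⟩
              L ^ j * (Y + ρ)           <⟨ *-monoʳ-< (L ^ j) {{m^n≢0 L j {{m^n≢0 l b {{≥2⇒nonZero 2≤l}}}}}} (<-≤-trans Y+ρ< hi) ⟩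
              L ^ j * (suc u * E ^ H)   ≡⟨ sym (*-assoc (L ^ j) (suc u) (E ^ H)) ⟩
              L ^ j * suc u * E ^ H     ≤⟨ *-monoˡ-≤ (E ^ H) upper ⟩
              suc (head a′) * E ^ J₂ * E ^ H ≡⟨ raise (suc (head a′)) J₂ ⟩
              suc (head a′) * E ^ (J₂ + H)  ∎)
          χ-out : χ (P * x) ≡ false
          χ-out = trans (cong χ (sym (+-identityʳ (P * x)))) (free 0 1≤P)
          residue₁ : (Y + ρ) % P ≡ z % P
          residue₁ = trans (cong (_% P) (eq₁ (l ^ α) P x ρ)) (trans ([m+kn]%n≡m%n ρ (l ^ α * x) P) (m%n%n≡m%n z P))
          residue₂ : (L ^ j * Y + ρ) % P ≡ z % P
          residue₂ = trans (cong (_% P) (eq₂ (L ^ j) (l ^ α) P x ρ)) (trans ([m+kn]%n≡m%n ρ (L ^ j * l ^ α * x) P) (m%n%n≡m%n z P))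
      in trans (same-cone {a} {J} {J₁ + H} cone cone₁ 2≤J (≤-trans 2≤J₁ (m≤m+n J₁ H)) (sym residue₁))
        (trans (sym (same χ-out))
        (same-cone {a′} {J₂ + H} {J′} cone₂ cone′ (≤-trans 2≤J₂ (m≤m+n J₂ H)) 2≤J′ (trans residue₂ eq)))
      where
      open ≤-Reasoning
      eq₁ : ∀ l P x ρ → l * (P * x) + ρ ≡ ρ + l * x * P
      eq₁ = solve-∀
      eq₂ : ∀ L l P x ρ → L * (l * (P * x)) + ρ ≡ ρ + L * l * x * P
      eq₂ = solve-∀

  -- pred P * b stands for - b modulo P.
  representative : ℕ → ℕ
  representative n = let b = head 0 * E ^ 2 in b + (n + pred P * b) % P

  f̃ : ℕ → Ω
  f̃ = f ∘ representative

  f̃-periodic : Periodic f̃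
  f̃-periodic = P , 1≤P , λ n → cong (λ t → f (head 0 * E ^ 2 + t))
    (trans (cong (_% P) (eq n P (pred P * (head 0 * E ^ 2)))) ([m+n]%n≡m%n (n + pred P * (head 0 * E ^ 2)) P))
    where
    eq : ∀ n p x → n + p + x ≡ n + x + p
    eq = solve-∀

  representative-cone : ∀ n → Cone E (head 0) 2 (representative n)
  representative-cone n = m≤m+n b _ , (begin-strict
    b + (n + pred P * b) % P   <⟨ +-monoʳ-< b (m%n<n (n + pred P * b) P) ⟩
    b + P                      ≤⟨ +-monoʳ-≤ b P≤E ⟩
    b + E                      ≤⟨ +-monoʳ-≤ b (m≤m*n E (E ^ 1) {{m^n≢0 E 1}}) ⟩
    b + E ^ 2                  ≡⟨ +-comm b (E ^ 2) ⟩
    suc (head 0) * E ^ 2       ∎)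
    where
    open ≤-Reasoning
    b = head 0 * E ^ 2

  representative-% : ∀ n → representative n % P ≡ n % P
  representative-% n = trans (%-cong-+ P {b} {b} refl (m%n%n≡m%n (n + pred P * b) P))
    (trans (cong (_% P) (sym (+-assoc b n (pred P * b)))) (%-complement P b n))
    where b = head 0 * E ^ 2

  agree : ∀ {a J n} → Cone E (head a) J n → 2 ≤ J → f n ≡ f̃ n
  agree {a} {J} {n} cone 2≤J =
    all-cones {a} {0} {J} {2} cone (representative-cone n) 2≤J ≤-refl (sym (representative-% n))

  -- By `agree`, a disagreement has no digit `c` in base `E` from position 2 on.
  disagreements-null : ∀ {χ} → (∀ n → χ n ≡ true → f n ≢ f̃ n) → Null χ
  disagreements-null h = null-avoids E c 2 c<E λ s n χn → Bool.¬-not λ out →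
      let J , a , 2≤J , cone = has-digit E c 2 s n out in h n χn (agree {a} {J} cone 2≤J)
    where
    c<E : c < E
    c<E = <-≤-trans c<K (≤-trans (≤-reflexive (sym (^-identityʳ K))) (^-monoʳ-≤ K 1≤φ))

-- Automata

module Run {k Q : ℕ} (δ : Fin k → Fin Q → Fin Q) where

  run : Fin Q → List (Fin k) → Fin Q
  run q [] = q
  run q (d ∷ w) = run (δ d q) w

  run-++ : ∀ q u v → run q (u ++ v) ≡ run (run q u) v
  run-++ q [] v = refl
  run-++ q (d ∷ u) v = run-++ (δ d q) u v

  pow : List (Fin k) → ℕ → List (Fin k)
  pow w zero = []
  pow w (suc n) = w ++ pow w n

  run-pow : ∀ q w n → run q (pow w (suc n)) ≡ run (run q (pow w n)) w
  run-pow q w zero = run-++ q w []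
  run-pow q w (suc n) = trans (run-++ q w (pow w (suc n)))
    (trans (run-pow (run q w) w n) (cong (λ p → run p w) (sym (run-++ q w (pow w n)))))

  run-pow-fixed : ∀ q w n → run q w ≡ q → run q (pow w n) ≡ q
  run-pow-fixed q w zero eq = refl
  run-pow-fixed q w (suc n) eq = trans (run-++ q w (pow w n))
    (trans (cong (λ p → run p (pow w n)) eq) (run-pow-fixed q w n eq))

  length-pow : ∀ w n → length (pow w n) ≡ n * length w
  length-pow w zero = refl
  length-pow w (suc n) = trans (length-++ w) (cong (length w +_) (length-pow w n))

  -- The states after powers of `w` have period `Q !` from exponent `Q` on, and `Q !` is itself at
  -- least `Q`.
  pow-idempotent : ∀ q w → run q (pow w (Q !) ++ pow w (Q !)) ≡ run q (pow w (Q !))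
  pow-idempotent q w = trans (cong (run q) (sym (pow-+ (Q !) (Q !))))
    (trans (cong (λ n → run q (pow w (Q ! + n))) (sym (*-identityˡ (Q !))))
      (eventually-periodic (λ n → run q (pow w n)) step (n≤n! Q) 1))
    where
    pow-+ : ∀ m n → pow w (m + n) ≡ pow w m ++ pow w n
    pow-+ zero n = refl
    pow-+ (suc m) n = trans (cong (w ++_) (pow-+ m n)) (sym (++-assoc w (pow w m) (pow w n)))
    step : ∀ i j → run q (pow w i) ≡ run q (pow w j) → run q (pow w (suc i)) ≡ run q (pow w (suc j))
    step i j eq = trans (run-pow q w i) (trans (cong (λ p → run p w) eq) (sym (run-pow q w j)))

  -- As in the pumping lemma, a loop between two equal states is cut out until at most `Q` letters
  -- remain.
  shorten : ∀ p w → ∃[ w′ ] length w′ ≤ Q × run p w′ ≡ run p w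
  shorten p w = go w (<-wellFounded (length w))
    where
    go : ∀ w → Acc _<_ (length w) → ∃[ w′ ] length w′ ≤ Q × run p w′ ≡ run p w
    go w (acc rec) = [ (λ short → w , short , refl) , long ]′ (≤-<-connex (length w) Q)
      where
      long : Q < length w → _
      long Q<len =
        let i , j , i<j , j≤Q , eq = pigeonhole-ℕ (λ i → run p (take i w))
            cut = take i w ++ drop j w
            j<len = ≤-<-trans j≤Q Q<len
            shorter : length cut < length w
            shorter = begin-strict
              length cut                     ≡⟨ trans (length-++ (take i w)) (cong₂ _+_ (length-take i w) (length-drop j w)) ⟩
              i ⊓ length w + (length w ∸ j)  ≤⟨ +-monoˡ-≤ (length w ∸ j) (m⊓n≤m i (length w)) ⟩
              i + (length w ∸ j)             <⟨ +-monoˡ-< (length w ∸ j) i<j ⟩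
              j + (length w ∸ j)             ≡⟨ m+[n∸m]≡n (<⇒≤ j<len) ⟩
              length w                       ∎
            w′ , short , same = go cut (rec shorter)
        in w′ , short , trans same (trans (run-++ p (take i w) (drop j w))
             (trans (cong (λ q → run q (drop j w)) eq)
             (trans (sym (run-++ p (take j w) (drop j w))) (cong (run p) (take++drop≡id j w)))))
        where open ≤-Reasoning

  Reach : Fin Q → Fin Q → Set
  Reach p q = ∃[ w ] run p w ≡ q

  reach-within? : ∀ n p q → Dec (∃[ w ] length w ≤ n × run p w ≡ q)
  reach-within? zero p q = map′ (λ eq → [] , z≤n , eq) (λ { ([] , _ , eq) → eq ; (_ ∷ _ , () , _) }) (p ≟ᶠ q)
  reach-within? (suc n) p q = map′
    (λ { (inj₁ eq) → [] , z≤n , eq ; (inj₂ (d , w , len , eq)) → d ∷ w , s≤s len , eq })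
    (λ { ([] , _ , eq) → inj₁ eq ; (d ∷ w , s≤s len , eq) → inj₂ (d , w , len , eq) })
    ((p ≟ᶠ q) ⊎-dec any? (λ d → reach-within? n (δ d p) q))

  reach? : ∀ p q → Dec (Reach p q)
  reach? p q = map′ (λ (w , _ , eq) → w , eq)
    (λ (w , eq) → let w′ , len , eq′ = shorten p w in w′ , len , trans eq′ eq)
    (reach-within? Q p q)

  reach-trans : ∀ {p q r} → Reach p q → Reach q r → Reach p r
  reach-trans {p} (u , refl) (v , refl) = u ++ v , run-++ p u v

  -- Membership in a terminal strongly connected component.
  Recurrent : Fin Q → Set
  Recurrent q = ∀ u → Reach (run q u) q

  recurrent-step : ∀ q u → Recurrent q → Recurrent (run q u)
  recurrent-step q u rec v = let x , eq = rec (u ++ v) in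
    x ++ u , trans (run-++ (run (run q u) v) x u)
      (cong (λ p → run p u) (trans (cong (λ p → run p x) (sym (run-++ q u v))) eq))

  -- A state from which no return is possible is left for one that witnesses
  -- this; by the pigeonhole principle this stops.
  reach-recurrent : ∀ q → ∃[ z ] Recurrent (run q z)
  reach-recurrent q =
    let i , j , i<j , _ , eq = pigeonhole-ℕ state
        z , z≡ = between 0 i z≤n
    in z , subst Recurrent (sym z≡) (settled (state i) (subst (Reach (state (suc i))) (sym eq) (between (suc i) j i<j)))
    where
    Escape : Fin Q → Fin Q → Set
    Escape s p = Reach s p × ¬ Reach p s
    escape? : ∀ s → Dec (∃[ p ] Escape s p)
    escape? s = any? (λ p → reach? s p ×-dec ¬? (reach? p s))
    next : Fin Q → Fin Q
    next s = case escape? s of λ where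
      (yes (p , _)) → p
      (no _) → s
    next-reach : ∀ s → Reach s (next s)
    next-reach s with escape? s
    ... | yes (p , reach , _) = reach
    ... | no _ = [] , refl
    settled : ∀ s → Reach (next s) s → Recurrent s
    settled s back with escape? s
    ... | yes (p , _ , ¬back) = contradiction back ¬back
    ... | no none = λ u → decidable-stable (reach? (run s u) s) λ ¬back → none (run s u , (u , refl) , ¬back)
    state : ℕ → Fin Q
    state zero = q
    state (suc i) = next (state i)
    between : ∀ i j → i ≤ j → Reach (state i) (state j)
    between i zero z≤n = [] , refl
    between i (suc j) i≤1+j = case m≤n⇒m<n∨m≡n i≤1+j of λ where
      (inj₁ i<1+j) → reach-trans (between i j (s≤s⁻¹ i<1+j)) (next-reach (state j))
      (inj₂ refl) → [] , refl

  -- The states are treated one by one; prolonging the word preserves recurrence where it has been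
  -- achieved.
  recurrent-word : ∀ w → ∃[ z ] ∀ q → Recurrent (run q (w ++ z))
  recurrent-word w = let z , all = go (allFin Q) in z , λ q → All.lookup all (∈-allFin q)
    where
    go : ∀ qs → ∃[ z ] All (λ q → Recurrent (run q (w ++ z))) qs
    go [] = [] , []
    go (q ∷ qs) =
      let z , all = go qs
          z′ , rec = reach-recurrent (run q (w ++ z))
          extend : ∀ p → run (run p (w ++ z)) z′ ≡ run p (w ++ z ++ z′)
          extend p = trans (sym (run-++ p (w ++ z) z′)) (cong (run p) (++-assoc w z z′))
      in z ++ z′ , subst Recurrent (extend q) rec ∷
         All.map (λ {p} r → subst Recurrent (extend p) (recurrent-step (run p (w ++ z)) z′ r)) all

-- Digit words and their values

module _ {k : ℕ} where

  val : List (Fin k) → ℕ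
  val [] = 0
  val (d ∷ w) = toℕ d * k ^ length w + val w

  val< : ∀ w → val w < k ^ length w
  val< [] = s≤s z≤n
  val< (d ∷ w) = <-≤-trans (+-monoʳ-< (toℕ d * k ^ length w) (val< w))
    (≤-trans (≤-reflexive (+-comm (toℕ d * k ^ length w) (k ^ length w))) (*-monoˡ-≤ (k ^ length w) (toℕ<n d)))

  digits : ∀ t v → v < k ^ t → ∃[ w ] length w ≡ t × val w ≡ v
  digits zero v v<1 = [] , refl , sym (n<1⇒n≡0 v<1)
  digits (suc t) v v< =
    let instance k^t≢0 = ≢-nonZero λ eq → <⇒≱ v< (≤-trans (≤-reflexive (trans (cong (k *_) eq) (*-zeroʳ k))) z≤n)
        d , lo , hi = divide (k ^ t) v
        d<k = *-cancelʳ-< (k ^ t) d k (≤-<-trans (≤-trans (≤-reflexive (*-comm d (k ^ t))) lo) v<)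
        v≡ = m+[n∸m]≡n lo
        w , len , eq = digits t (v ∸ k ^ t * d) (+-cancelˡ-< (k ^ t * d) _ _
          (subst₂ _<_ (sym v≡) (trans (*-suc (k ^ t) d) (+-comm (k ^ t) _)) hi))
    in fromℕ< d<k ∷ w , cong suc len ,
       trans (cong₂ _+_ (trans (cong₂ (λ d l → d * k ^ l) (toℕ-fromℕ< d<k) len) (*-comm d (k ^ t))) eq) v≡

  cone-digits : ∀ {n t m} → Cone k n t m → ∃[ w ] length w ≡ t × m ≡ k ^ length w * n + val w
  cone-digits {n} {t} {m} (lo , hi) =
    let m≡ = m+[n∸m]≡n lo
        w , len , eq = digits t (m ∸ n * k ^ t) (+-cancelˡ-< (n * k ^ t) _ _
          (subst₂ _<_ (sym m≡) (+-comm (k ^ t) _) hi))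
    in w , len , trans (sym m≡) (cong₂ _+_ (trans (*-comm n (k ^ t)) (cong (λ t → k ^ t * n) (sym len))) (sym eq))

module Automaton {k Q : ℕ} (δ : Fin k → Fin Q → Fin Q) (W : ℕ → Fin Q)
  (W-step : ∀ n d → W (k * n + toℕ d) ≡ δ d (W n)) where

  open Run δ public

  W-run : ∀ n w → W (k ^ length w * n + val w) ≡ run (W n) w
  W-run n [] = cong W (trans (+-identityʳ (1 * n)) (*-identityˡ n))
  W-run n (d ∷ w) = trans (cong W (eq k (k ^ length w) n (toℕ d) (val w)))
    (trans (W-run (k * n + toℕ d) w) (cong (λ q → run q w) (W-step n d)))
    where
    eq : ∀ k x n d v → k * x * n + (d * x + v) ≡ x * (k * n + d) + v
    eq = solve-∀

  W-cone : ∀ {n t m} → Cone k n t m → ∃[ w ] length w ≡ t × W m ≡ run (W n) w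
  W-cone {n} {t} {m} cone = let w , len , m≡ = cone-digits {k} {n} {t} {m} cone in
    w , len , trans (cong W m≡) (W-run n w)

  -- A letter which does not change the state can be used as padding.
  padded : ∀ p q r a u v → run p u ≡ q → δ a q ≡ q → run q v ≡ r →
    ∃[ w ] length w ≡ 2 * Q × run p w ≡ r
  padded p q r a u v pu aq qv =
    let u′ , u≤ , pu′ = shorten p u
        v′ , v≤ , qv′ = shorten q v
        s = 2 * Q ∸ (length u′ + length v′)
        w = u′ ++ pow (a ∷ []) s ++ v′
        uv≤ : length u′ + length v′ ≤ 2 * Q
        uv≤ = ≤-trans (+-mono-≤ u≤ v≤) (≤-reflexive (cong (Q +_) (sym (+-identityʳ Q))))
    in w ,
       trans (length-++ u′) (trans (cong (length u′ +_) (trans (length-++ (pow (a ∷ []) s))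
         (cong (_+ length v′) (trans (length-pow (a ∷ []) s) (*-identityʳ s)))))
         (trans (eq (length u′) s (length v′)) (m+[n∸m]≡n uv≤))) ,
       trans (run-++ p u′ _) (trans (cong (λ t → run t (pow (a ∷ []) s ++ v′)) (trans pu′ pu))
         (trans (run-++ q (pow (a ∷ []) s) v′)
         (trans (cong (λ t → run t v′) (run-pow-fixed q (a ∷ []) s aq)) (trans qv′ qv))))
    where
    eq : ∀ u s v → u + (s + v) ≡ u + v + s
    eq = solve-∀

module Letter {k Q : ℕ} (2≤k : 2 ≤ k) (δ : Fin k → Fin Q → Fin Q) (W : ℕ → Fin Q)
  (W-step : ∀ n d → W (k * n + toℕ d) ≡ δ d (W n)) where

  open Automaton δ W W-step

  private instance
    k≢0 : NonZero k
    k≢0 = ≥2⇒nonZero 2≤k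

  -- The leading digit 1 makes the letter c nonzero.
  one : Fin k
  one = fromℕ< 2≤k

  -- With `Q !` written as a successor, `e` unfolds to `z ++ pow z h` and begins with `one`.
  h : ℕ
  h = pred (Q !)

  Q!≡ : Q ! ≡ suc h
  Q!≡ = sym (suc-pred (Q !) {{Q !≢0}})

  opaque
    recurrent : ∃[ z ] ∀ q → Recurrent (run q ((one ∷ []) ++ z))
    recurrent = recurrent-word (one ∷ [])

  -- The factor `z` leads to recurrent states, and the exponent `Q !` makes `e` idempotent. In base
  -- `K` the word `e` is the single digit `c`.
  z e : List (Fin k)
  z = one ∷ proj₁ recurrent
  e = pow z (suc h)

  τ K c : ℕ
  τ = length e
  K = k ^ τ
  c = val e

  1≤τ : 1 ≤ τ
  1≤τ = s≤s z≤n

  2≤K : 2 ≤ K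
  2≤K = 2≤^ 2≤k 1≤τ

  1≤c : 1 ≤ c
  1≤c = ≤-trans (*-mono-≤ (≤-reflexive (sym (toℕ-fromℕ< 2≤k))) (m^n>0 k (pred τ))) (m≤m+n (toℕ one * k ^ pred τ) _)

  c<K : c < K
  c<K = val< e

  e-idempotent : ∀ q → run (run q e) e ≡ run q e
  e-idempotent q = trans (sym (run-++ q e e))
    (subst (λ n → run q (pow z n ++ pow z n) ≡ run q (pow z n)) Q!≡ (pow-idempotent q z))

  -- Recurrence leads back to the state after the first `z`; reading `pow z h` then completes `e`.
  e-return : ∀ q u → Reach (run q (e ++ u)) (run q e)
  e-return q u =
    let x , eq = proj₂ recurrent q (pow z h ++ u)
    in x ++ pow z h , trans (run-++ (run q (e ++ u)) x (pow z h))
      (trans (cong (λ p → run p (pow z h)) (trans (cong (λ p → run p x)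
          (trans (cong (run q) (++-assoc z (pow z h) u)) (run-++ q z (pow z h ++ u)))) eq))
        (sym (run-++ q z (pow z h))))

  -- Iterating the loop u ++ x makes its length a multiple of τ.
  e-return-multiple : ∀ q u s → length u ≡ τ * s →
    ∃[ x ] ∃[ s′ ] length x ≡ τ * s′ × run (run q (e ++ u)) x ≡ run q e
  e-return-multiple q u s len =
    let x , eq = e-return q u
        w = u ++ x
        loop : run (run q e) w ≡ run q e
        loop = trans (run-++ (run q e) u x) (trans (cong (λ p → run p x) (sym (run-++ q e u))) eq)
        y = x ++ pow w (pred τ)
        total : length u + length y ≡ τ * length w
        total = trans (sym (length-++ u)) (trans (cong length (sym (++-assoc u x (pow w (pred τ)))))
          (length-pow w τ))
    in y , length w ∸ s ,
       trans (sym (m+n∸m≡n (length u) (length y))) (trans (cong₂ _∸_ total len) (sym (*-distribˡ-∸ τ (length w) s))) ,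
       trans (run-++ _ x (pow w (pred τ))) (trans (cong (λ p → run p (pow w (pred τ))) eq)
         (run-pow-fixed (run q e) w (pred τ) loop))

  K^≡ : ∀ s → K ^ s ≡ k ^ (τ * s)
  K^≡ = ^-*-assoc k τ

  Δ : Fin K → Fin Q → Fin Q
  Δ d q = run q (proj₁ (digits τ (toℕ d) (toℕ<n d)))

  opaque
    W-stepᴷ : ∀ n d → W (K * n + toℕ d) ≡ Δ d (W n)
    W-stepᴷ n d = let w , len , eq = digits τ (toℕ d) (toℕ<n d) in
      trans (cong₂ (λ t v → W (k ^ t * n + v)) (sym len) (sym eq)) (W-run n w)

  module Big = Automaton Δ W W-stepᴷ

  W-head : ∀ a → W (K * a + c) ≡ run (W a) e
  W-head a = W-run a e

  letter : Fin K
  letter = fromℕ< c<K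

  letter-fixes : ∀ a → Δ letter (W (K * a + c)) ≡ W (K * a + c)
  letter-fixes a = trans (sym (W-stepᴷ (K * a + c) letter))
    (trans (cong (λ d → W (K * (K * a + c) + d)) (toℕ-fromℕ< c<K))
    (trans (W-head (K * a + c)) (trans (cong (λ q → run q e) (W-head a))
      (trans (e-idempotent (W a)) (sym (W-head a))))))

  T₀ : ℕ
  T₀ = 2 * Q

  opaque
    -- The route runs from `W m` back to `W (K * a + c)` and on to `W m′`. The digit `c` fixes the
    -- middle state, so padding there gives the length `T₀` in all cases.
    connect : ∀ a {β β′ m m′} → Cone K (K * a + c) β m → Cone K (K * a + c) β′ m′ →
      ∃[ y ] y < K ^ T₀ × W (K ^ T₀ * m + y) ≡ W m′
    connect a {β} {β′} {m} {m′} cone cone′ =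
      let n₀ = K * a + c
          u , len , Wm = W-cone {n₀} {τ * β} {m} (subst (λ x → n₀ * x ≤ m × m < suc n₀ * x) (K^≡ β) cone)
          x , s , lenx , back = e-return-multiple (W a) u β len
          Wm≡ : W m ≡ run (W a) (e ++ u)
          Wm≡ = trans Wm (trans (cong (λ q → run q u) (W-head a)) (sym (run-++ (W a) e u)))
          m⁺ = k ^ length x * m + val x
          cone⁺ : Cone K m s m⁺
          cone⁺ = subst (λ t → m * t ≤ m⁺ × m⁺ < suc m * t) (trans (cong (k ^_) lenx) (sym (K^≡ s)))
            (≤-trans (≤-reflexive (*-comm m _)) (m≤m+n _ (val x)) ,
             <-≤-trans (+-monoʳ-< (k ^ length x * m) (val< x)) (≤-reflexive (trans (+-comm _ (k ^ length x)) (cong (k ^ length x +_) (*-comm _ m)))))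
          X , _ , WX = Big.W-cone {m} {s} {m⁺} cone⁺
          U , _ , WU = Big.W-cone {n₀} {β′} {m′} cone′
          X-back : Big.run (W m) X ≡ W n₀
          X-back = trans (sym WX) (trans (W-run m x) (trans (cong (λ q → run q x) Wm≡) (trans back (sym (W-head a)))))
          w , lenw , eq = Big.padded (W m) (W n₀) (W m′) letter X U X-back (letter-fixes a) (sym WU)
      in val w , subst (λ t → val w < K ^ t) lenw (val< w) ,
         trans (cong (λ t → W (K ^ t * m + val w)) (sym lenw)) (trans (Big.W-run m w) eq)

    -- `τ` is at least `Q` and a multiple of `Q !`, so `τ` further zeros leave the state unchanged.
    zeros : ∀ n → W (K * (K * n)) ≡ W (K * n)
    zeros n = trans (cong W (trans (sym (*-assoc K K n)) (cong (_* n) (trans (sym (^-distribˡ-+-* k τ τ))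
        (cong (λ t → k ^ (τ + t)) τ≡)))))
      (eventually-periodic (λ i → W (k ^ i * n)) step Q≤τ (length z))
      where
      zero′ : Fin k
      zero′ = fromℕ< {0} (<-≤-trans (s≤s z≤n) 2≤k)
      τ≡ : τ ≡ length z * Q !
      τ≡ = trans (length-pow z (suc h)) (trans (*-comm (suc h) (length z)) (cong (length z *_) (sym Q!≡)))
      Q≤τ : Q ≤ τ
      Q≤τ = ≤-trans (n≤n! Q) (≤-trans (m≤n*m (Q !) (length z)) (≤-reflexive (sym τ≡)))
      append : ∀ i → W (k ^ suc i * n) ≡ δ zero′ (W (k ^ i * n))
      append i = trans (cong W (trans (*-assoc k (k ^ i) n)
        (trans (sym (+-identityʳ _)) (cong (k * (k ^ i * n) +_) (sym (toℕ-fromℕ< _)))))) (W-step (k ^ i * n) zero′)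
      step : ∀ i j → W (k ^ i * n) ≡ W (k ^ j * n) → W (k ^ suc i * n) ≡ W (k ^ suc j * n)
      step i j eq = trans (append i) (trans (cong (δ zero′) eq) (sym (append j)))

-- Upper density

count≡cnt : ∀ {p} {A : Pred ℕ p} (A? : Decidable A) N → count A? N ≡ cnt (does ∘ A?) N
count≡cnt A? zero = refl
count≡cnt A? (suc N) = trans (cong (length ∘ filter A?) (sym (upTo-∷ʳ N)))
  (trans (cong length (filter-++ A? (upTo N) (N ∷ [])))
  (trans (length-++ (filter A? (upTo N)))
  (trans (+-comm _ (length (filter A? (N ∷ []))))
  (cong₂ _+_ last (count≡cnt A? N)))))
  where
  last : length (filter A? (N ∷ [])) ≡ bit (does (A? N))
  last with does (A? N)
  ... | true = refl
  ... | false = refl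

fraction-<⁻ : ∀ c n a d → (ℤ.+ c /ℚ suc n) ℚ.< (ℤ.+ a /ℚ suc d) → c * suc d < a * suc n
fraction-<⁻ c n a d lt = drop‿+<+ (subst₂ ℤ._<_ (sym (pos-* c (suc d))) (sym (pos-* a (suc n)))
  (drop-*<* (ℚᵘ.<-respʳ-≃ (toℚᵘ-fromℚᵘ (mkℚᵘ (ℤ.+ a) d)) (<-respˡ-≃ (toℚᵘ-fromℚᵘ (mkℚᵘ (ℤ.+ c) n)) (toℚᵘ-mono-< lt)))))

fraction-<⁺ : ∀ c n a d {p} → toℚᵘ p ≡ mkℚᵘ (ℤ.+ a) d → c * suc d < a * suc n → (ℤ.+ c /ℚ suc n) ℚ.< p
fraction-<⁺ c n a d {p} p≡ lt = toℚᵘ-cancel-< (subst (toℚᵘ (ℤ.+ c /ℚ suc n) ℚᵘ.<_) (sym p≡)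
  (<-respˡ-≃ (≃-sym (toℚᵘ-fromℚᵘ (mkℚᵘ (ℤ.+ c) n)))
    (ℚᵘ.*<* (subst₂ ℤ._<_ (pos-* c (suc d)) (pos-* a (suc n)) (+<+ lt)))))

almost-all⇒null : ∀ {p} {P : Pred ℕ p} (P? : Decidable P) → ForAlmostAll P? →
  Null (does ∘ ∁? P?)
almost-all⇒null P? limsup zero = 0 , λ _ _ → z≤n
almost-all⇒null P? limsup (suc M) =
  let ε = ℤ.+ 1 /ℚ suc M
      0<ε : 0ℚ ℚ.< ε
      0<ε = toℚᵘ-cancel-< (ℚᵘ.<-respʳ-≃ (≃-sym (toℚᵘ-fromℚᵘ (mkℚᵘ (ℤ.+ 1) M))) (ℚᵘ.*<* (+<+ (s≤s z≤n))))
      N₀ , bound = proj₁ (limsup ε 0<ε)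
  -- The quotient with index `N` counts below `suc N`.
  in suc N₀ , λ where
    (suc N) (s≤s N₀≤N) → begin
      suc M * cnt (does ∘ ∁? P?) (suc N)  ≡⟨ cong (suc M *_) (sym (count≡cnt (∁? P?) (suc N))) ⟩
      suc M * count (∁? P?) (suc N)       ≡⟨ *-comm (suc M) _ ⟩
      count (∁? P?) (suc N) * suc M       ≤⟨ <⇒≤ (fraction-<⁻ (count (∁? P?) (suc N)) N 1 M (subst (ℤ.+ count (∁? P?) (suc N) /ℚ suc N ℚ.<_) (ℚ.+-identityˡ ε) (bound N N₀≤N))) ⟩
      1 * suc N                           ≡⟨ *-identityˡ (suc N) ⟩
      suc N                               ∎
  where open ≤-Reasoning

-- The factor 2 makes the upper estimate strict; the lower half of the limsup holds because the
-- quotients are nonnegative.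
null⇒almost-all : ∀ {p} {P : Pred ℕ p} (P? : Decidable P) → Null (does ∘ ∁? P?) →
  ForAlmostAll P?
null⇒almost-all P? null (mkℚ (ℤ.+ zero) d _) (*<* (+<+ ()))
null⇒almost-all P? null ε@(mkℚ (ℤ.+ suc a) d _) 0<ε =
  let N₀ , bound = null (2 * suc d) in
  (N₀ , λ N N₀≤N → subst (ℤ.+ count (∁? P?) (suc N) /ℚ suc N ℚ.<_) (sym (ℚ.+-identityˡ ε)) (fraction-<⁺ (count (∁? P?) (suc N)) N (suc a) d refl
    (<-≤-trans (small N (bound (suc N) (m≤n⇒m≤1+n N₀≤N))) (m≤n*m (suc N) (suc a))))) ,
  λ N₀ → N₀ , ≤-refl , ℚ.<-≤-trans
    (subst (ℚ._< 0ℚ) (sym (ℚ.+-identityˡ (ℚ.- ε))) (neg-antimono-< 0<ε))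
    (nonNegative⁻¹ _ {{normalize-nonNeg (count (∁? P?) (suc N₀)) (suc N₀)}})
  where
  small : ∀ N → 2 * suc d * cnt (does ∘ ∁? P?) (suc N) ≤ suc N → count (∁? P?) (suc N) * suc d < suc N
  small N le = *-cancelˡ-< 2 _ _ (≤-<-trans
    (≤-trans (≤-reflexive (trans (cong (λ c → 2 * (c * suc d)) (count≡cnt (∁? P?) (suc N))) (eq (suc d) _))) le)
    (m<m+n (suc N) (s≤s z≤n)))
    where
    eq : ∀ d c → 2 * (c * d) ≡ 2 * d * c
    eq = solve-∀

-- Kernels

module _ {ω} {Ω : Set ω} {k : ℕ} where

  kernel-section : ∀ (f : ℕ → Ω) α r → r < k ^ α → Kernel k f (λ n → f (k ^ α * n + r))
  kernel-section f α r r< = α , r , r< , λ _ → refl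

  kernel-self : ∀ (f : ℕ → Ω) → Kernel k f f
  kernel-self f = 0 , 0 , s≤s z≤n , λ n → cong f (sym (trans (+-identityʳ (1 * n)) (*-identityˡ n)))

  kernel-step : ∀ {f g : ℕ → Ω} → Kernel k f g → ∀ {r} → r < k → Kernel k f (λ n → g (k * n + r))
  kernel-step {f} {g} (α , s , s< , g≗) {r} r<k = suc α , k ^ α * r + s , bound ,
    λ n → trans (g≗ (k * n + r)) (cong f (eq k (k ^ α) n r s))
    where
    bound : k ^ α * r + s < k ^ suc α
    bound = <-≤-trans (+-monoʳ-< (k ^ α * r) s<) (≤-trans
      (≤-reflexive (trans (+-comm (k ^ α * r) (k ^ α)) (sym (*-suc (k ^ α) r))))
      (≤-trans (*-monoʳ-≤ (k ^ α) r<k) (≤-reflexive (*-comm (k ^ α) k))))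
    eq : ∀ k x n r s → x * (k * n + r) + s ≡ k * x * n + (x * r + s)
    eq = solve-∀

quotient< : ∀ r x c .{{_ : NonZero x}} → r < c * x → r / x < c
quotient< r x c r< = *-cancelʳ-< x (r / x) c (≤-<-trans (≤-trans (m≤n+m _ (r % x)) (≤-reflexive (sym (m≡m%n+[m/n]*n r x)))) r<)

-- W n records g (A * n + e) for all g in the k-kernel, A ≤ A* and e ≤ 2 * A*.
-- With these bounds W (k * n + d) depends on W n and d only, as
-- A * d + e < k * (2 * A* + 1).
module State {ω} {Ω : Set ω} {m} (Ω↔Fin : Ω ↔ Fin m) {k} (2≤k : 2 ≤ k)
  (f : ℕ → Ω) (auto : Automatic k f) (A* : ℕ) (1≤A* : 1 ≤ A*) where

  private instance
    k≢0 : NonZero k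
    k≢0 = ≥2⇒nonZero 2≤k

  xs = proj₁ auto

  #e : ℕ
  #e = suc (2 * A*)

  #Ae : ℕ
  #Ae = suc A* * #e

  #views : ℕ
  #views = length xs * #Ae

  find : ∀ {g} → Kernel k f g → ∃[ i ] g ≗ lookup xs i
  find {g} ker = let p = proj₂ (proj₂ auto) g ker in index p , lookup-index p

  kernel : ∀ i → Kernel k f (lookup xs i)
  kernel i = All.lookup (proj₁ (proj₂ auto)) (∈-lookup i)

  decode : Fin #views → Fin (length xs) × Fin (suc A*) × Fin #e
  decode t = let i , s = remQuot #Ae t in i , remQuot #e s

  encode : Fin (length xs) → Fin (suc A*) → Fin #e → Fin #views
  encode i A e = combine i (combine A e)

  decode-encode : ∀ i A e → decode (encode i A e) ≡ (i , A , e)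
  decode-encode i A e = trans (cong (λ (i , s) → i , remQuot #e s) (remQuot-combine i (combine A e)))
    (cong (i ,_) (remQuot-combine A e))

  value : Fin (length xs) × Fin (suc A*) × Fin #e → ℕ → Ω
  value (i , A , e) n = lookup xs i (toℕ A * n + toℕ e)

  view : Fin #views → ℕ → Fin m
  view t n = Inverse.to Ω↔Fin (value (decode t) n)

  Q : ℕ
  Q = m ^ #views

  W : ℕ → Fin Q
  W n = funToFin (λ t → view t n)

  W-view : ∀ t n → finToFun (W n) t ≡ view t n
  W-view t n = finToFun-funToFin (λ t → view t n) t

  opaque
    -- Divide `A * d + e` by `k`: the remainder selects the new kernel element, the quotient is the
    -- new offset, and `A` is kept.
    next : ∀ (d : Fin k) t → ∃[ t′ ] ∀ n → view t (k * n + toℕ d) ≡ view t′ n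
    next d t =
      let i , A , e = decode t
          y = toℕ A * toℕ d + toℕ e
          j , j≗ = find (kernel-step {f = f} (kernel i) (m%n<n y k))
          A≤ = s≤s⁻¹ (toℕ<n A)
          e≤ = s≤s⁻¹ (toℕ<n e)
          q<#e : y / k < #e
          q<#e = quotient< y k #e (<-≤-trans (s≤s (begin
            toℕ A * toℕ d + toℕ e    ≤⟨ +-mono-≤ (*-monoˡ-≤ (toℕ d) A≤) e≤ ⟩
            A* * toℕ d + 2 * A*      ≡⟨ eq₁ A* (toℕ d) ⟩
            A* * suc (toℕ d) + A*    ≤⟨ +-mono-≤ (*-monoʳ-≤ A* (toℕ<n d)) (m≤m*n A* k) ⟩
            A* * k + A* * k          ≡⟨ eq₂ A* k ⟩
            2 * A* * k               ≤⟨ m≤n+m _ (pred k) ⟩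
            pred k + 2 * A* * k      ∎)) (≤-reflexive (cong (_+ 2 * A* * k) (suc-pred k))))
          e′ = fromℕ< q<#e
      in encode j A e′ , λ n → cong (Inverse.to Ω↔Fin) (        (trans (cong (lookup xs i) (trans (eq₃ (toℕ A) k n (toℕ d) (toℕ e))
          (trans (cong (k * (toℕ A * n) +_) (m≡m%n+[m/n]*n y k)) (eq₄ k (toℕ A * n) (y % k) (y / k)))))
        (trans (j≗ (toℕ A * n + y / k))
        (trans (cong (λ q → lookup xs j (toℕ A * n + q)) (sym (toℕ-fromℕ< q<#e)))
          (cong (λ t → value t n) (sym (decode-encode j A e′)))))))
      where
      open ≤-Reasoning
      eq₁ : ∀ a d → a * d + 2 * a ≡ a * suc d + a
      eq₁ = solve-∀
      eq₂ : ∀ a k → a * k + a * k ≡ 2 * a * k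
      eq₂ = solve-∀
      eq₃ : ∀ a k n d e → a * (k * n + d) + e ≡ k * (a * n) + (a * d + e)
      eq₃ = solve-∀
      eq₄ : ∀ k x r q → k * x + (r + q * k) ≡ k * (x + q) + r
      eq₄ = solve-∀

  δ : Fin k → Fin Q → Fin Q
  δ d q = funToFin (λ t → finToFun q (proj₁ (next d t)))

  funToFin-cong : ∀ {s} {g h : Fin s → Fin m} → g ≗ h → funToFin g ≡ funToFin h
  funToFin-cong {zero} g≗h = refl
  funToFin-cong {suc s} g≗h = cong₂ combine (g≗h Fin.zero) (funToFin-cong (g≗h ∘ Fin.suc))

  W-step : ∀ n d → W (k * n + toℕ d) ≡ δ d (W n)
  W-step n d = funToFin-cong λ t →
    trans (proj₂ (next d t) n) (sym (W-view (proj₁ (next d t)) n))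

  opaque
    sees : ∀ {n n′} → W n ≡ W n′ → ∀ {g} → Kernel k f g → ∀ {A e} → A ≤ A* → e ≤ 2 * A* →
      g (A * n + e) ≡ g (A * n′ + e)
    sees {n} {n′} Wn ker {A} {e} A≤ e≤ =
      let i , g≗ = find ker
          a = fromℕ< (s≤s A≤)
          ε = fromℕ< (s≤s e≤)
          t = encode i a ε
          val≡ : ∀ n → value (decode t) n ≡ lookup xs i (A * n + e)
          val≡ n = trans (cong (λ t → value t n) (decode-encode i a ε))
            (cong₂ (λ A e → lookup xs i (A * n + e)) (toℕ-fromℕ< (s≤s A≤)) (toℕ-fromℕ< (s≤s e≤)))
          same : view t n ≡ view t n′
          same = trans (sym (W-view t n)) (trans (cong (λ q → finToFun q t) Wn) (W-view t n′))
      in trans (g≗ _) (trans (sym (val≡ n)) (trans (Injection.injective (↔⇒↣ Ω↔Fin) same)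
           (trans (val≡ n′) (sym (g≗ _)))))

    lift-k : Lifts f W k
    lift-k b {n} {n′} Wn {r} r< =
      let instance
            k^b≢0 : NonZero (k ^ b)
            k^b≢0 = m^n≢0 k b
          x = k ^ b
          q<2 = quotient< r x 2 r<
          split : ∀ n → x * n + r ≡ x * (1 * n + r / x) + r % x
          split n = trans (cong (x * n +_) (m≡m%n+[m/n]*n r x)) (eq x n (r % x) (r / x))
      in trans (cong f (split n)) (trans
          (sees Wn (kernel-section f b (r % x) (m%n<n r x)) 1≤A* (≤-trans (<⇒≤ q<2) (*-monoʳ-≤ 2 1≤A*)))
          (cong f (sym (split n′))))
      where
      eq : ∀ x n r q → x * n + (r + q * x) ≡ x * (1 * n + q) + r
      eq = solve-∀

module AlmostKernel {ω} {Ω : Set ω} (_≟Ω_ : DecidableEquality Ω) {l} (2≤l : 2 ≤ l)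
  (f : ℕ → Ω) (auto : Asymptotic.AsymptoticallyAutomatic _≟Ω_ l f) where

  open Asymptotic _≟Ω_

  private instance
    l≢0 : NonZero l
    l≢0 = ≥2⇒nonZero 2≤l

  ys = proj₁ auto

  differ : (g h : ℕ → Ω) → ℕ → Bool
  differ g h n = not (does (g n ≟Ω h n))

  differ-false : ∀ {g h n} → differ g h n ≡ false → g n ≡ h n
  differ-false {g} {h} {n} = undecide (g n ≟Ω h n)
    where
    undecide : ∀ {p} {A : Set p} (a? : Dec A) → not (does a?) ≡ false → A
    undecide (yes a) _ = a

  differ-true : ∀ {g h n} → differ g h n ≡ true → g n ≢ h n
  differ-true {g} {h} {n} = undecide (g n ≟Ω h n)
    where
    undecide : ∀ {p} {A : Set p} (a? : Dec A) → not (does a?) ≡ true → ¬ A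
    undecide (no ¬a) _ = ¬a

  opaque
    class : ∀ {g} → Kernel l f g → ∃[ i ] Null (differ g (lookup ys i))
    class {g} ker = let p = proj₂ (proj₂ auto) g ker in
      index p , almost-all⇒null (λ n → g n ≟Ω lookup ys (index p) n) (lookup-index p)

  ys-kernel : ∀ i → Kernel l f (lookup ys i)
  ys-kernel i = All.lookup (proj₁ (proj₂ auto)) (∈-lookup i)

  opaque
    -- Each representative is itself a section of `f` along multiples of a power of `l`; `A*` bounds
    -- these powers, so that `W` can record the sections.
    scale-bound : ∃[ A* ] 1 ≤ A* × (∀ i → l ^ proj₁ (ys-kernel i) ≤ A*)
    scale-bound = let A* , b = go (length ys) (λ i → l ^ proj₁ (ys-kernel i)) in
      suc A* , s≤s z≤n , λ i → m≤n⇒m≤1+n (b i)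
      where
      go : ∀ n (g : Fin n → ℕ) → ∃[ A ] ∀ i → g i ≤ A
      go zero g = 0 , λ ()
      go (suc n) g = let A , b = go n (g ∘ Fin.suc) in g Fin.zero ⊔ A , λ where
        Fin.zero → m≤m⊔n _ A
        (Fin.suc i) → ≤-trans (b i) (m≤n⊔m (g Fin.zero) A)

  opaque
    -- Two of the sections with residue `ρ` fall into the same class. The exponents start at `ρ` to
    -- ensure `ρ < l ^ (ρ + i)`.
    dilate : AlmostDilates f l
    dilate ρ =
      let i , j , i<j , _ , eq = pigeonhole-ℕ (λ i → proj₁ (class (ker i)))
          y = lookup ys (proj₁ (class (ker i)))
          α = ρ + i
          b = j ∸ i
          α+b≡ : α + b ≡ ρ + j
          α+b≡ = trans (+-assoc ρ i b) (cong (ρ +_) (m+[n∸m]≡n (<⇒≤ i<j)))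
          χ = λ n → differ (h i) y n ∨ differ (h j) y n
          null-χ : Null χ
          null-χ = null-∨ (proj₂ (class (ker i)))
            (subst (λ t → Null (differ (h j) (lookup ys t))) (sym eq) (proj₂ (class (ker j))))
          agree : ∀ {x} → χ x ≡ false → f (l ^ (α + b) * x + ρ) ≡ f (l ^ α * x + ρ)
          agree {x} out = trans (cong (λ t → f (l ^ t * x + ρ)) α+b≡)
            (trans (differ-false {h j} {y} {x} (∨-conicalʳ (differ (h i) y x) _ out))
              (sym (differ-false {h i} {y} {x} (∨-conicalˡ _ _ out))))
      in α , b , m<n⇒0<n∸m i<j , iterate α b χ null-χ agree
      where
      h : ℕ → ℕ → Ω
      h i n = f (l ^ (ρ + i) * n + ρ)
      ker : ∀ i → Kernel l f (h i)
      ker i = kernel-section f (ρ + i) ρ (<-≤-trans (n<^n 2≤l ρ) (^-monoʳ-≤ l (m≤m+n ρ i)))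
      -- The step after `i` dilations is applied at `L ^ i * x`, so the exceptional set is a union
      -- of `j` affine preimages.
      iterate : ∀ α b χ → Null χ → (∀ {x} → χ x ≡ false → f (l ^ (α + b) * x + ρ) ≡ f (l ^ α * x + ρ)) →
        ∀ j → ∃[ χ ] Null χ × (∀ {x} → χ x ≡ false → f ((l ^ b) ^ j * (l ^ α * x) + ρ) ≡ f (l ^ α * x + ρ))
      iterate α b χ null-χ agree j =
        ⋃ j χs , null-⋃ j (λ i _ → null-affine (L ^ i) 0 (m^n>0 L {{m^n≢0 l b}} i) null-χ) ,
        λ out → go j out
        where
        L : ℕ
        L = l ^ b
        χs : ℕ → ℕ → Bool
        χs i n = χ (L ^ i * n + 0)
        eq₁ : ∀ L y a x → L * y * (a * x) ≡ a * L * (y * x + 0)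
        eq₁ = solve-∀
        eq₂ : ∀ y a x → a * (y * x + 0) ≡ y * (a * x)
        eq₂ = solve-∀
        go : ∀ j {x} → ⋃ j χs x ≡ false → f (L ^ j * (l ^ α * x) + ρ) ≡ f (l ^ α * x + ρ)
        go zero {x} _ = cong (λ t → f (t + ρ)) (*-identityˡ (l ^ α * x))
        go (suc j) {x} out = trans
          (cong (λ t → f (t + ρ)) (trans (eq₁ L (L ^ j) (l ^ α) x) (cong (_* (L ^ j * x + 0)) (sym (^-distribˡ-+-* l α b)))))
          (trans (agree (∨-conicalˡ (χs j x) _ out))
          (trans (cong (λ t → f (t + ρ)) (eq₂ (L ^ j) (l ^ α) x))
            (go j (∨-conicalʳ (χs j x) _ out))))

module Lift {ω} {Ω : Set ω} {m} (Ω↔Fin : Ω ↔ Fin m) {k l} (2≤k : 2 ≤ k) (2≤l : 2 ≤ l)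
  (f : ℕ → Ω) (auto-k : Automatic k f)
  (auto-l : Asymptotic.AsymptoticallyAutomatic (finite⇒≟ Ω↔Fin) l f) where

  open AlmostKernel (finite⇒≟ Ω↔Fin) 2≤l f auto-l public

  A* = proj₁ scale-bound

  open State Ω↔Fin 2≤k f auto-k A* (proj₁ (proj₂ scale-bound)) public

  private instance
    l≢0 : NonZero l
    l≢0 = ≥2⇒nonZero 2≤l

  opaque
    -- Off a null set a section at scale `l ^ α` equals its representative, a section at some scale
    -- `l ^ β ≤ A*`. So the finitely many values in `W` suffice for every `α`.
    lift-l : AlmostLifts f W l
    lift-l α = ⋃ (2 * x) χs , null-⋃ (2 * x) (λ r _ → null-affine 1 (r / x) (s≤s z≤n) (proj₂ (class (ker r)))) ,
      λ {n} {n′} out out′ Wn {r} r< →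
        let i = proj₁ (class (ker r))
            β , s , s< , y≗ = ys-kernel i
            bound = proj₂ (proj₂ scale-bound) i
            q = r / x
            toY : ∀ {n} → ⋃ (2 * x) χs n ≡ false → f (x * n + r) ≡ f (l ^ β * n + (l ^ β * q + s))
            toY {n} out = trans (cong f (trans (cong (x * n +_) (m≡m%n+[m/n]*n r x)) (eq₁ x n (r % x) q)))
              (trans (differ-false {h r} {lookup ys i} {1 * n + q} (∉⋃ (2 * x) out r<))
              (trans (y≗ (1 * n + q)) (cong f (eq₂ (l ^ β) n q s))))
        in trans (toY out) (trans
          (sees Wn (kernel-self f) bound (+-mono-≤
            (≤-trans (*-monoʳ-≤ (l ^ β) (s≤s⁻¹ (quotient< r x 2 r<))) (≤-trans (≤-reflexive (*-identityʳ (l ^ β))) bound))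
            (≤-trans (<⇒≤ s<) (≤-trans bound (≤-reflexive (sym (+-identityʳ A*)))))))
          (sym (toY out′)))
      where
      x : ℕ
      x = l ^ α
      instance
        x≢0 : NonZero x
        x≢0 = m^n≢0 l α
      h : ℕ → ℕ → Ω
      h r n = f (x * n + r % x)
      ker : ∀ r → Kernel l f (h r)
      ker r = kernel-section f α (r % x) (m%n<n r x)
      χs : ℕ → ℕ → Bool
      χs r n = differ (h r) (lookup ys (proj₁ (class (ker r)))) (1 * n + r / x)
      eq₁ : ∀ x n r q → x * n + (r + q * x) ≡ x * (1 * n + q) + r
      eq₁ = solve-∀
      eq₂ : ∀ y n q s → y * (1 * n + q) + s ≡ y * n + (y * q + s)
      eq₂ = solve-∀

-- Disagreement is measured by the Boolean sets contained in it; decidable equality on `Ω` enters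
-- only when the final statement is derived.
AlmostPeriodic : ∀ {ω} {Ω : Set ω} → (ℕ → Ω) → Set ω
AlmostPeriodic {Ω = Ω} f = ∃[ f̃ ] Periodic f̃ ×
  (∀ (χ : ℕ → Bool) → (∀ n → χ n ≡ true → f n ≢ f̃ n) → Null χ)

opaque
  connected⇒periodic : ∀ {ω} {Ω : Set ω} (f : ℕ → Ω) {Q} (W : ℕ → Fin Q)
    {K l} → 2 ≤ K → 2 ≤ l → MultiplicativelyIndependent K l →
    Lifts f W K → AlmostLifts f W l → AlmostDilates f l →
    (∀ n → W (K * (K * n)) ≡ W (K * n)) →
    ∀ c T₀ → 1 ≤ c → c < K →
    (∀ a {β β′ m m′} → Cone K (K * a + c) β m → Cone K (K * a + c) β′ m′ →
      ∃[ y ] y < K ^ T₀ × W (K ^ T₀ * m + y) ≡ W m′) →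
    AlmostPeriodic f
  connected⇒periodic f W {K} {l} 2≤K 2≤l ind lift-K lift-l dilate zeros c T₀ 1≤c c<K connect =
    G.f̃ , G.f̃-periodic , λ χ h → G.disagreements-null h
    where
    module C = CommonPeriod f W 2≤K 2≤l (independent-sym 2≤K 2≤l ind) lift-K lift-l c T₀ connect
    module G = Gluing f W 2≤K 2≤l ind lift-K zeros dilate c 1≤c c<K C.P C.b C.1≤P C.cone-period

  automaton⇒periodic : ∀ {ω} {Ω : Set ω} (f : ℕ → Ω) {k l Q} → 2 ≤ k → 2 ≤ l → MultiplicativelyIndependent k l →
    (δ : Fin k → Fin Q → Fin Q) (W : ℕ → Fin Q) → (∀ n d → W (k * n + toℕ d) ≡ δ d (W n)) →
    Lifts f W k → AlmostLifts f W l → AlmostDilates f l →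
    AlmostPeriodic f
  automaton⇒periodic f {k} {l} 2≤k 2≤l ind δ W W-step lift-k lift-l dilate =
    connected⇒periodic f W 2≤K 2≤l ind-K lift-K lift-l dilate zeros c T₀ 1≤c c<K connect
    where
    open Letter 2≤k δ W W-step
    ind-K : MultiplicativelyIndependent K l
    ind-K = subst (MultiplicativelyIndependent K) (*-identityʳ l) (powers-independent τ 1 1≤τ ind)
    lift-K : Lifts f W K
    lift-K b {n} {n′} Wn {r} = subst (λ t → r < 2 * t → f (t * n + r) ≡ f (t * n′ + r))
      (sym (K^≡ b)) (lift-k (τ * b) Wn)

theoremB : ∀ {a} (Ω : Set a) (m : ℕ) (Ω↔Fin : Ω ↔ Fin m) →
    let open Asymptotic (finite⇒≟ Ω↔Fin) in
    ∀ (k l : ℕ) → 2 ≤ k → 2 ≤ l → MultiplicativelyIndependent k l →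
    ∀ (f : ℕ → Ω) → Automatic k f → AsymptoticallyAutomatic l f →
    ∃[ f̃ ] Periodic f̃ × f ≃ f̃
theoremB Ω m Ω↔Fin k l 2≤k 2≤l ind f auto-k auto-l =
  let f̃ , periodic , null = automaton⇒periodic f 2≤k 2≤l ind δ W W-step lift-k lift-l dilate
  in f̃ , periodic , null⇒almost-all (λ n → finite⇒≟ Ω↔Fin (f n) (f̃ n))
    (null _ λ n → differ-true {f} {f̃} {n})
  where
  open Lift Ω↔Fin 2≤k 2≤l f auto-k auto-l
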